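{- Fix a prime power $q\geq 2$. Let $B_1,\dots,B_n\subseteq \mathbb{F}_q^n$ be independent uniformly random bases of the vector space $\mathbb{F}_q^n$ (each chosen uniformly at random among all bases of $\mathbb{F}_q^n$). Then, with probability $1-o(1)$ as $n\to \infty$, the multi-set $B_1\cup \dots\cup B_n$ can be partitioned into $n$ bases of $\mathbb{F}_q^n$ which are transversal with respect to $B_1,\dots,B_n$.
   Context: A basis $B\subseteq B_1\cup\dots\cup B_n$ (a sub-multiset of the multi-set union) is called transversal with respect to $B_1,\dots,B_n$ if it contains exactly one vector from each of $B_1,\dots,B_n$; here $B_1,\dots,B_n$ are regarded as subsets of the multi-set $B_1\cup\dots\cup B_n$, and if a vector appears in several of the bases, its copies in the multi-set are distinguished by which $B_i$ they come from. -}

module Defs where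

open import Level using (0ℓ)
open import Data.Nat using (ℕ; zero; suc)
open import Data.Fin using (Fin)
open import Data.Vec using (Vec; []; _∷_; replicate; zipWith; map; lookup; tabulate)
open import Data.Product using (Σ; ∃; _×_)
open import Data.Fin.Permutation using (Permutation′; _⟨$⟩ʳ_)
open import Function.Bundles using (_↔_)
open import Relation.Binary.PropositionalEquality using (_≡_; _≢_)
open import Relation.Nullary using (¬_)
open import Algebra.Structures using (IsCommutativeRing)

-- A finite field with exactly q elements, realised on the carrier Fin q
-- (every field with q elements is isomorphic to one of these).

record FiniteField (q : ℕ) : Set where
  field
    _+_ _*_   : Fin q → Fin q → Fin q
    -_        : Fin q → Fin q
    0# 1#     : Fin q
    isCommutativeRing : IsCommutativeRing _≡_ _+_ _*_ -_ 0# 1#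
    0≢1       : 0# ≢ 1#
    inverse   : ∀ x → x ≢ 0# → ∃ λ y → x * y ≡ 1#

module LinAlg {q : ℕ} (F : FiniteField q) where
  open FiniteField F

  K = Fin q

  Vector : ℕ → Set
  Vector n = Vec K n

  0v : ∀ {n} → Vector n
  0v = replicate _ 0#

  _+v_ : ∀ {n} → Vector n → Vector n → Vector n
  _+v_ = zipWith _+_

  _·v_ : ∀ {n} → K → Vector n → Vector n
  a ·v v = map (a *_) v

  lincomb : ∀ {n m} → Vec K m → Vec (Vector n) m → Vector n
  lincomb []       []       = 0v
  lincomb (c ∷ cs) (v ∷ vs) = (c ·v v) +v lincomb cs vs

  LinearlyIndependent : ∀ {n m} → Vec (Vector n) m → Set
  LinearlyIndependent vs = ∀ c → lincomb c vs ≡ 0v → c ≡ replicate _ 0#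

  Spanning : ∀ {n m} → Vec (Vector n) m → Set
  Spanning {n} vs = ∀ (w : Vector n) → ∃ λ c → lincomb c vs ≡ w

  IsBasis : ∀ {n} → Vec (Vector n) n → Set
  IsBasis vs = LinearlyIndependent vs × Spanning vs

  BasisFamily : ℕ → Set
  BasisFamily n = Vec (Vec (Vector n) n) n

  -- The multiset B_1 ∪ … ∪ B_n can be partitioned into n bases that are
  -- transversal w.r.t. B_1,…,B_n: for each i a permutation σ_i of the
  -- positions of B_i, such that for every k the family
  -- ( B_i[σ_i(k)] )_i  (one vector from each B_i) is a basis.
  -- The k-th transversal basis takes the element σ_i(k) of each B_i;
  -- as σ_i is a bijection, these n bases partition the multiset.
  TransversallyPartitionable : ∀ {n} → BasisFamily n → Set
  TransversallyPartitionable {n} B =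
    ∃ λ (σ : Fin n → Permutation′ n) →
      ∀ (k : Fin n) → IsBasis (tabulate λ i → lookup (lookup B i) (σ i ⟨$⟩ʳ k))

-- Subtypes with (definitionally) irrelevant proof component, so that the
-- number of elements counts only the underlying data.

record Sub (A : Set) (P : A → Set) : Set where
  constructor ⟨_,_⟩
  field
    elem   : A
    .proof : P elem

HasSize : Set → ℕ → Set
HasSize A m = A ↔ Fin m

module Prob {q : ℕ} (F : FiniteField q) where
  open LinAlg F

  -- sample space: n-tuples of (ordered) bases of F^n, uniform measure
  Ω : ℕ → Set
  Ω n = Sub (BasisFamily n) (λ B → ∀ i → IsBasis (lookup B i))

  BadΩ : ℕ → Set
  BadΩ n = Sub (BasisFamily n)
              (λ B → (∀ i → IsBasis (lookup B i)) × ¬ TransversallyPartitionable B)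

{-# OPTIONS --safe #-}
module Submission where

-- Fix s and L = s of order log n. In the last n − L rows the identity permutation is used throughout: by a
-- union bound, with high probability every column of this part is linearly independent, and moreover any s
-- nonzero functionals annihilating s different columns are linearly independent. The remaining L rows are
-- added one at a time. Let fₖ be a nonzero functional vanishing on the vectors already placed in column k;
-- it suffices to permute the new basis so that its k-th entry is not in the kernel of fₖ. Any s of the fₖ
-- are independent, so in the bipartite graph of pairs (k, b) with fₖ · b ≠ 0 all degrees are at least s and
-- any s columns and s basis vectors span an edge, up to exceptional probability about n s q⁻ˢ; in such a graph an
-- arbitrary bijection is repaired into a perfect matching by rotating the entries of at most three columns at a time.
--
-- All probabilities come from one inequality: for subspaces Vⱼ, the events bⱼ ∈ Vⱼ for distinct vectors of a
-- uniformly random basis satisfy P(∀ j. bⱼ ∈ Vⱼ) ≤ ∏ⱼ |Vⱼ| / qⁿ, because |V| |U| ≤ qⁿ |V ∩ U| for the span U of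
-- the vectors chosen before.
open import Defs
open import Level using (0ℓ)
open import Algebra.Bundles using (CommutativeRing; AbelianGroup)
import Algebra.Properties.AbelianGroup as GroupProperties
import Algebra.Properties.Ring as RingProperties
open import Data.Fin using (Fin; zero; suc; toℕ; fromℕ<; combine; inject≤)
open import Data.Fin.Permutation as Perm using (Permutation′; _⟨$⟩ʳ_; _⟨$⟩ˡ_; transpose; _∘ₚ_)
import Data.Fin.Properties as Fin
open import Data.List using (List; []; _∷_; _++_)
import Data.List as List
open import Data.List.Relation.Unary.Any as Any using (Any; here; there)
open import Data.Maybe using (Maybe; just; nothing)
import Data.Nat as ℕ
open import Data.Nat using (ℕ; zero; suc; _+_; _*_; _^_; _∸_; _≤_; _<_; z≤n; s≤s; NonZero; >-nonZero; _≤′_; ≤′-refl; ≤′-step)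
open import Data.Nat.Properties hiding (_≟_)
open import Data.Nat.Tactic.RingSolver using (solve-∀)
open import Data.Product using (∃; ∃₂; _×_; _,_; proj₁; proj₂)
open import Data.Sum using (_⊎_; inj₁; inj₂)
open import Data.Unit using (⊤; tt)
open import Data.Vec using (Vec; []; _∷_; lookup; map; tabulate)
import Data.Vec.Properties as Vec
open import Function using (_∘_; _⟨_⟩_)
open import Function.Bundles using (Inverse)
open import Relation.Binary.Definitions using (DecidableEquality)
open import Relation.Binary.PropositionalEquality
open import Relation.Nullary using (¬_; Dec; yes; no; contradiction; recompute)
open import Relation.Nullary.Decidable using (map′; _×-dec_; _⊎-dec_; _→-dec_; ¬?; decidable-stable; dec-true; dec-false)

-- Counting over finite types

-- The identity permutation cannot be used to the end: for fixed q the span of a nearly complete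
-- column contains the next random vector with probability of order 1/q, which does not tend to 0.
-- Stopping L rows early makes a dependent column as rare as q⁻ᴸ. The obstacle in the remaining rows
-- is that the fₖ depend on permutations already chosen. Their independence is therefore demanded of
-- the unpermuted part only, but for all tuples of nonzero annihilators at once: what annihilates a
-- longer column annihilates its unpermuted part, so a single event serves every later row. Its
-- price is a union bound over about q to the n (s - 1) tuples with sum zero, against a probability
-- of about q to the - m s, where m = n - L. Since m s - n (s - 1) = n - L s, this is affordable
-- while L s is small compared with n. A lower bound for s comes from density: about n to the 2 s
-- pairs of s columns and s vectors compete with a probability q to the - s², so s must exceed twice
-- the logarithm of n to the base q.

ind : {P : Set} → Dec P → ℕ
ind (yes _) = 1
ind (no _)  = 0

ind-mono : {P Q : Set} (p : Dec P) (r : Dec Q) → (P → Q) → ind p ≤ ind r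
ind-mono (yes p) (yes _) f = ≤-refl
ind-mono (yes p) (no ¬q) f = contradiction (f p) ¬q
ind-mono (no _)  r       f = z≤n

ind-≡ : {P Q : Set} (p : Dec P) (r : Dec Q) → (P → Q) → (Q → P) → ind p ≡ ind r
ind-≡ p r f g = ≤-antisym (ind-mono p r f) (ind-mono r p g)

ind-yes : {P : Set} (p : Dec P) → P → ind p ≡ 1
ind-yes (yes _) _ = refl
ind-yes (no ¬p) p = contradiction p ¬p

ind-no : {P : Set} (p : Dec P) → ¬ P → ind p ≡ 0
ind-no (yes p) ¬p = contradiction p ¬p
ind-no (no _)  _  = refl

ind≤1 : {P : Set} (p : Dec P) → ind p ≤ 1
ind≤1 (yes _) = ≤-refl
ind≤1 (no _)  = z≤n

ind-× : {P Q : Set} (p : Dec P) (r : Dec Q) → ind (p ×-dec r) ≡ ind p * ind r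
ind-× (yes _) (yes _) = refl
ind-× (yes _) (no _)  = refl
ind-× (no _)  _       = refl

ind-¬ : {P : Set} (p : Dec P) → ind p + ind (¬? p) ≡ 1
ind-¬ (yes _) = refl
ind-¬ (no _)  = refl

ind-⊎ : {P Q R : Set} (r : Dec R) (p : Dec P) (q : Dec Q) → (R → P ⊎ Q) → ind r ≤ ind p + ind q
ind-⊎ (no _)  p q f = z≤n
ind-⊎ (yes r) p q f with f r
... | inj₁ x = ≤-trans (≤-reflexive (sym (ind-yes p x))) (m≤m+n (ind p) (ind q))
... | inj₂ x = ≤-trans (≤-reflexive (sym (ind-yes q x))) (m≤n+m (ind q) (ind p))

sumOver : {A : Set} → List A → (A → ℕ) → ℕ
sumOver []       f = 0
sumOver (x ∷ xs) f = f x + sumOver xs f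

sumOver-mono : {A : Set} (xs : List A) {f g : A → ℕ} → (∀ x → f x ≤ g x) →
               sumOver xs f ≤ sumOver xs g
sumOver-mono []       h = z≤n
sumOver-mono (x ∷ xs) h = +-mono-≤ (h x) (sumOver-mono xs h)

sumOver-cong : {A : Set} (xs : List A) {f g : A → ℕ} → (∀ x → f x ≡ g x) →
               sumOver xs f ≡ sumOver xs g
sumOver-cong []       h = refl
sumOver-cong (x ∷ xs) h = cong₂ _+_ (h x) (sumOver-cong xs h)

sumOver-+ : {A : Set} (xs : List A) (f g : A → ℕ) →
            sumOver xs (λ x → f x + g x) ≡ sumOver xs f + sumOver xs g
sumOver-+ []       f g = refl
sumOver-+ (x ∷ xs) f g rewrite sumOver-+ xs f g = interchange (f x) (g x) _ _
  where
  interchange : ∀ a b c d → (a + b) + (c + d) ≡ (a + c) + (b + d)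
  interchange = solve-∀

sumOver-* : {A : Set} (xs : List A) (c : ℕ) (f : A → ℕ) →
            sumOver xs (λ x → c * f x) ≡ c * sumOver xs f
sumOver-* []       c f = sym (*-zeroʳ c)
sumOver-* (x ∷ xs) c f rewrite sumOver-* xs c f = sym (*-distribˡ-+ c (f x) (sumOver xs f))

sumOver-0 : {A : Set} (xs : List A) → sumOver xs (λ _ → 0) ≡ 0
sumOver-0 []       = refl
sumOver-0 (_ ∷ xs) = sumOver-0 xs

sumOver-swap : {A B : Set} (xs : List A) (ys : List B) (f : A → B → ℕ) →
               sumOver xs (λ x → sumOver ys (f x)) ≡ sumOver ys (λ y → sumOver xs (λ x → f x y))
sumOver-swap []       ys f = sym (sumOver-0 ys)
sumOver-swap (x ∷ xs) ys f rewrite sumOver-swap xs ys f =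
  sym (sumOver-+ ys (f x) (λ y → sumOver xs (λ x → f x y)))

sumOver-++ : {A : Set} (xs ys : List A) (f : A → ℕ) →
             sumOver (xs ++ ys) f ≡ sumOver xs f + sumOver ys f
sumOver-++ []       ys f = refl
sumOver-++ (x ∷ xs) ys f rewrite sumOver-++ xs ys f = sym (+-assoc (f x) _ _)

sumOver-map : {A B : Set} (h : A → B) (xs : List A) (f : B → ℕ) →
              sumOver (List.map h xs) f ≡ sumOver xs (λ x → f (h x))
sumOver-map h []       f = refl
sumOver-map h (x ∷ xs) f = cong (f (h x) +_) (sumOver-map h xs f)

sumOver-concatMap : {A B : Set} (h : A → List B) (xs : List A) (f : B → ℕ) →
                    sumOver (List.concatMap h xs) f ≡ sumOver xs (λ x → sumOver (h x) f)
sumOver-concatMap h []       f = refl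
sumOver-concatMap h (x ∷ xs) f =
  trans (sumOver-++ (h x) (List.concatMap h xs) f)
        (cong (sumOver (h x) f +_) (sumOver-concatMap h xs f))

-- `once` packs exhaustiveness and absence of repetitions into one equation: the Kronecker delta of
-- every element has sum 1, which is the form that `∑-pick` and `∑-unique` consume.
record Finite (A : Set) : Set where
  infix 4 _≟_
  field
    elems : List A
    _≟_   : DecidableEquality A
    once  : ∀ a → sumOver elems (λ x → ind (x ≟ a)) ≡ 1

open Finite {{...}} using (_≟_)

opaque
  ∑ : {A : Set} {{_ : Finite A}} → (A → ℕ) → ℕ
  ∑ {{fin}} = sumOver (Finite.elems fin)

card : (A : Set) {{_ : Finite A}} → ℕ
card A = ∑ {A} (λ _ → 1)

opaque
  unfolding ∑

  ∑≡sumOver : {A : Set} {{fin : Finite A}} (f : A → ℕ) → ∑ f ≡ sumOver (Finite.elems fin) f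
  ∑≡sumOver f = refl

  ∑-mono : {A : Set} {{_ : Finite A}} {f g : A → ℕ} → (∀ x → f x ≤ g x) → ∑ f ≤ ∑ g
  ∑-mono {{fin}} = sumOver-mono (Finite.elems fin)

  ∑-cong : {A : Set} {{_ : Finite A}} {f g : A → ℕ} → (∀ x → f x ≡ g x) → ∑ f ≡ ∑ g
  ∑-cong {{fin}} = sumOver-cong (Finite.elems fin)

  ∑-+ : {A : Set} {{_ : Finite A}} (f g : A → ℕ) → ∑ (λ x → f x + g x) ≡ ∑ f + ∑ g
  ∑-+ {{fin}} = sumOver-+ (Finite.elems fin)

  ∑-*ˡ : {A : Set} {{_ : Finite A}} (c : ℕ) (f : A → ℕ) → ∑ (λ x → c * f x) ≡ c * ∑ f
  ∑-*ˡ {{fin}} = sumOver-* (Finite.elems fin)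

  ∑-0 : {A : Set} {{_ : Finite A}} → ∑ {A} (λ _ → 0) ≡ 0
  ∑-0 {{fin}} = sumOver-0 (Finite.elems fin)

  ∑-swap : {A B : Set} {{_ : Finite A}} {{_ : Finite B}} (f : A → B → ℕ) →
           ∑ (λ x → ∑ (f x)) ≡ ∑ (λ y → ∑ (λ x → f x y))
  ∑-swap {{fin}} {{fin′}} = sumOver-swap (Finite.elems fin) (Finite.elems fin′)

  ∑-δ : {A : Set} {{_ : Finite A}} (a : A) → ∑ (λ x → ind (x ≟ a)) ≡ 1
  ∑-δ {{fin}} = Finite.once fin

module _ {A : Set} {{fin : Finite A}} where

  private E = Finite.elems fin

  ∑-*ʳ : (f : A → ℕ) (c : ℕ) → ∑ (λ x → f x * c) ≡ ∑ f * c
  ∑-*ʳ f c = trans (∑-cong (λ x → *-comm (f x) c)) (trans (∑-*ˡ c f) (*-comm c (∑ f)))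

  ∑-const : (c : ℕ) → ∑ {A} (λ _ → c) ≡ card A * c
  ∑-const c = trans (∑-cong {f = λ _ → c} {g = λ _ → 1 * c} (λ _ → sym (*-identityˡ c))) (∑-*ʳ (λ _ → 1) c)

  ∑-pick : (a : A) (f : A → ℕ) → ∑ (λ x → ind (x ≟ a) * f x) ≡ f a
  ∑-pick a f = trans (∑-cong pt) (trans (∑-*ʳ (λ x → ind (x ≟ a)) (f a))
                 (trans (cong (_* f a) (∑-δ a)) (*-identityˡ (f a))))
    where
    pt : ∀ x → ind (x ≟ a) * f x ≡ ind (x ≟ a) * f a
    pt x with x ≟ a
    ... | yes refl = refl
    ... | no _     = refl

  ∑-term : (f : A → ℕ) (a : A) → f a ≤ ∑ f
  ∑-term f a = subst (_≤ ∑ f) (∑-pick a f) (∑-mono λ x →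
    ≤-trans (*-monoˡ-≤ (f x) (ind≤1 (x ≟ a))) (≤-reflexive (*-identityˡ (f x))))

  ∑-bound : {f : A → ℕ} {c : ℕ} → (∀ x → f x ≤ c) → ∑ f ≤ card A * c
  ∑-bound {c = c} h = ≤-trans (∑-mono h) (≤-reflexive (∑-const c))

  opaque
    ∃? : {P : A → Set} → (∀ x → Dec (P x)) → Dec (∃ P)
    ∃? {P} P? = map′ Any.satisfied (λ (a , pa) → Any.map (λ eq → subst P (sym eq) pa) (mem a))
                  (Any.any? P? (E))
      where
      find : (a : A) (xs : List A) → sumOver xs (λ x → ind (x ≟ a)) ≢ 0 → Any (_≡ a) xs
      find a []       h = contradiction refl h
      find a (x ∷ xs) h with x ≟ a
      ... | yes eq = here eq
      ... | no _   = there (find a xs h)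
      mem : (a : A) → Any (_≡ a) (E)
      mem a = find a _ λ eq → contradiction (trans (sym eq) (Finite.once fin a)) λ ()

    ∀? : {P : A → Set} → (∀ x → Dec (P x)) → Dec (∀ x → P x)
    ∀? P? = map′ (λ h x → decidable-stable (P? x) λ ¬p → h (x , ¬p)) (λ h (x , ¬p) → ¬p (h x))
              (¬? (∃? λ x → ¬? (P? x)))

  union-bound : {Q : Set} {P : A → Set} (q? : Dec Q) (P? : ∀ x → Dec (P x)) →
                (Q → ∃ P) → ind q? ≤ ∑ (λ x → ind (P? x))
  union-bound (no _)  P? h = z≤n
  union-bound (yes q) P? h = let (x , p) = h q in
    ≤-trans (≤-reflexive (sym (ind-yes (P? x) p))) (∑-term (λ x → ind (P? x)) x)

  ∑-unique : {P : A → Set} (P? : ∀ x → Dec (P x)) → (∀ x y → P x → P y → x ≡ y) →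
             ∑ (λ x → ind (P? x)) ≤ 1
  ∑-unique P? u with ∃? P?
  ... | yes (a , pa) = ≤-trans (∑-mono λ x → ind-mono (P? x) (x ≟ a) λ p → u x a p pa)
                               (≤-reflexive (∑-δ a))
  ... | no ¬e = ≤-trans (∑-mono {g = λ _ → 0} λ x → ≤-reflexive (ind-no (P? x) λ p → ¬e (x , p)))
                  (≤-trans (≤-reflexive ∑-0) z≤n)

-- Each `g (φ x)` is spread over all `y` by a delta; after the sums are swapped, injectivity leaves
-- every `y` hit at most once. Translations, pigeonhole arguments and dimension counts below all
-- rest on this.
∑-inject : {A B : Set} {{_ : Finite A}} {{_ : Finite B}} (φ : A → B) →
           (∀ x y → φ x ≡ φ y → x ≡ y) → (f : A → ℕ) (g : B → ℕ) →
           (∀ x → f x ≤ g (φ x)) → ∑ f ≤ ∑ g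
∑-inject φ inj f g h = begin
  ∑ f                                       ≤⟨ ∑-mono h ⟩
  ∑ (λ x → g (φ x))                         ≡⟨ ∑-cong (λ x → sym (∑-pick (φ x) g)) ⟩
  ∑ (λ x → ∑ λ y → ind (y ≟ φ x) * g y)     ≡⟨ ∑-swap (λ x y → ind (y ≟ φ x) * g y) ⟩
  ∑ (λ y → ∑ λ x → ind (y ≟ φ x) * g y)     ≡⟨ ∑-cong (λ y → ∑-*ʳ (λ x → ind (y ≟ φ x)) (g y)) ⟩
  ∑ (λ y → ∑ (λ x → ind (y ≟ φ x)) * g y)   ≤⟨ ∑-mono (λ y → *-monoˡ-≤ (g y)
    (∑-unique (λ x → y ≟ φ x) λ x x′ e e′ → inj x x′ (trans (sym e) e′))) ⟩
  ∑ (λ y → 1 * g y)                         ≡⟨ ∑-cong (λ y → *-identityˡ (g y)) ⟩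
  ∑ g                                       ∎
  where open ≤-Reasoning

elemsVec : {A : Set} → List A → (n : ℕ) → List (Vec A n)
elemsVec xs zero    = [] ∷ []
elemsVec xs (suc n) = List.concatMap (λ a → List.map (a ∷_) (elemsVec xs n)) xs

sumOver-Vec : {A : Set} (xs : List A) (n : ℕ) (f : Vec A (suc n) → ℕ) →
              sumOver (elemsVec xs (suc n)) f ≡ sumOver xs (λ a → sumOver (elemsVec xs n) (λ v → f (a ∷ v)))
sumOver-Vec xs n f = trans (sumOver-concatMap _ xs f)
  (sumOver-cong xs λ a → sumOver-map (a ∷_) (elemsVec xs n) f)

sumOver-tabulate : ∀ n {B : Set} (h : Fin n → B) (f : B → ℕ) →
                   sumOver (List.tabulate h) f ≡ sumOver (List.tabulate {n = n} λ i → i) (λ i → f (h i))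
sumOver-tabulate zero    h f = refl
sumOver-tabulate (suc n) h f = cong (f (h zero) +_)
  (trans (sumOver-tabulate n (λ i → h (suc i)) f) (sym (sumOver-tabulate n suc (λ i → f (h i)))))

instance
  finFin : ∀ {n} → Finite (Fin n)
  finFin = record { elems = List.allFin _ ; _≟_ = Fin._≟_ ; once = once′ _ }
    where
    once′ : ∀ n (a : Fin n) → sumOver (List.allFin n) (λ x → ind (x Fin.≟ a)) ≡ 1
    once′ (suc n) zero = cong suc (trans (sumOver-tabulate n suc (λ x → ind (x Fin.≟ zero))) (sumOver-0 (List.allFin n)))
    once′ (suc n) (suc a) = trans (sumOver-tabulate n suc (λ x → ind (x Fin.≟ suc a)))
      (trans (sumOver-cong (List.allFin n) eq)
             (once′ n a))
      where
      eq : ∀ x → ind (suc x Fin.≟ suc a) ≡ ind (x Fin.≟ a)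
      eq x = ind-≡ (suc x Fin.≟ suc a) (x Fin.≟ a) Fin.suc-injective (cong suc)

  finVec : {A : Set} {n : ℕ} {{_ : Finite A}} → Finite (Vec A n)
  finVec {A} {n} {{fin}} = record { elems = elemsVec E n ; _≟_ = eq ; once = once′ n }
    where
    E = Finite.elems fin
    eq : ∀ {n} → DecidableEquality (Vec A n)
    eq = Vec.≡-dec _≟_
    split : ∀ {n} (b a : A) (w v : Vec A n) →
            ind (eq (b ∷ w) (a ∷ v)) ≡ ind (b ≟ a) * ind (eq w v)
    split b a w v = trans
      (ind-≡ (eq (b ∷ w) (a ∷ v)) ((b ≟ a) ×-dec eq w v) Vec.∷-injective λ (p , r) → cong₂ _∷_ p r)
      (ind-× (b ≟ a) (eq w v))
    once′ : ∀ n (a : Vec A n) → sumOver (elemsVec E n) (λ x → ind (eq x a)) ≡ 1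
    once′ zero    []      = refl
    once′ (suc n) (a ∷ v) = trans (sumOver-Vec E n _) (trans (sumOver-cong E inner) (Finite.once fin a))
      where
      inner : ∀ b → sumOver (elemsVec E n) (λ w → ind (eq (b ∷ w) (a ∷ v))) ≡ ind (b ≟ a)
      inner b = trans (sumOver-cong (elemsVec E n) λ w → split b a w v)
        (trans (sumOver-* (elemsVec E n) (ind (b ≟ a)) (λ w → ind (eq w v)))
        (trans (cong (ind (b ≟ a) *_) (once′ n v)) (*-identityʳ _)))

card-Fin : ∀ n → card (Fin n) ≡ n
card-Fin n = trans (∑≡sumOver (λ _ → 1)) (go n (λ i → i))
  where
  go : ∀ n {B : Set} (h : Fin n → B) → sumOver (List.tabulate h) (λ _ → 1) ≡ n
  go zero    h = refl
  go (suc n) h = cong suc (go n (λ i → h (suc i)))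

∑-Fin : ∀ {n} (f : Fin (suc n) → ℕ) → ∑ f ≡ f zero + ∑ (λ i → f (suc i))
∑-Fin {n} f = trans (∑≡sumOver f) (cong (f zero +_) (trans (sumOver-tabulate n suc f) (sym (∑≡sumOver (λ i → f (suc i))))))

module _ {A : Set} {{fin : Finite A}} where

  ∑-Vec : ∀ {n} (f : Vec A (suc n) → ℕ) → ∑ f ≡ ∑ λ a → ∑ λ v → f (a ∷ v)
  ∑-Vec {n} f = trans (∑≡sumOver f) (trans (sumOver-Vec E n f)
    (sym (trans (∑≡sumOver _) (sumOver-cong E λ a → ∑≡sumOver _))))
    where E = Finite.elems fin

  card-Vec : ∀ n → card (Vec A n) ≡ card A ^ n
  card-Vec zero    = ∑≡sumOver (λ _ → 1)
  card-Vec (suc n) = trans (∑-Vec {n} (λ _ → 1)) (trans (∑-const {A} (card (Vec A n))) (cong (card A *_) (card-Vec n)))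

-- Probabilities appear as integer inequalities "count times `c` is at most `M`", so no division
-- occurs. In the applications `c` is a power of q and `M` a multiple of the number of outcomes.
union-count : {A B : Set} {{_ : Finite A}} {{_ : Finite B}} {Q : B → Set} {P : A → B → Set}
              (Q? : ∀ b → Dec (Q b)) (P? : ∀ a b → Dec (P a b)) (c M : ℕ) →
              (∀ b → Q b → ∃ λ a → P a b) → (∀ a → (∑ λ b → ind (P? a b)) * c ≤ M) →
              (∑ λ b → ind (Q? b)) * c ≤ card A * M
union-count Q? P? c M cover bounds = begin
  (∑ λ b → ind (Q? b)) * c               ≤⟨ *-monoˡ-≤ c (∑-mono λ b → union-bound (Q? b) (λ a → P? a b) (cover b)) ⟩
  (∑ λ b → ∑ λ a → ind (P? a b)) * c     ≡⟨ cong (_* c) (∑-swap _) ⟩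
  (∑ λ a → ∑ λ b → ind (P? a b)) * c     ≡⟨ sym (∑-*ʳ _ c) ⟩
  (∑ λ a → (∑ λ b → ind (P? a b)) * c)   ≤⟨ ∑-bound bounds ⟩
  card _ * M                             ∎
  where open ≤-Reasoning

Injective : ∀ {a b} → (Fin a → Fin b) → Set
Injective f = ∀ x y → f x ≡ f y → x ≡ y

injective? : ∀ {a b} (f : Fin a → Fin b) → Dec (Injective f)
injective? f = ∀? λ x → ∀? λ y → (f x ≟ f y) →-dec (x ≟ y)

-- The product structure of the sample space: a condition imposed on every row separately has its
-- probability raised to the power `m`.
count-all : {A : Set} {{_ : Finite A}} {P : A → Set} (P? : ∀ a → Dec (P a)) (m : ℕ) →
            (∑ λ (v : Vec A m) → ind (∀? λ i → P? (lookup v i))) ≡ (∑ λ a → ind (P? a)) ^ m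
count-all P? zero    = trans (∑-cong λ v → ind-yes (∀? λ i → P? (lookup v i)) λ ()) (card-Vec 0)
count-all P? (suc m) = begin
  (∑ λ v → ind (∀? λ i → P? (lookup v i)))                             ≡⟨ ∑-Vec _ ⟩
  (∑ λ a → ∑ λ v → ind (∀? λ i → P? (lookup (a ∷ v) i)))               ≡⟨ ∑-cong (λ a → ∑-cong λ v → trans
    (ind-≡ (∀? λ i → P? (lookup (a ∷ v) i)) (P? a ×-dec ∀? λ i → P? (lookup v i))
      (λ h → h zero , λ i → h (suc i)) λ { (p , h) zero → p ; (p , h) (suc i) → h i })
    (ind-× (P? a) (∀? λ i → P? (lookup v i)))) ⟩
  (∑ λ a → ∑ λ v → ind (P? a) * ind (∀? λ i → P? (lookup v i)))        ≡⟨ ∑-cong (λ a → ∑-*ˡ (ind (P? a)) _) ⟩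
  (∑ λ a → ind (P? a) * ∑ λ v → ind (∀? λ i → P? (lookup v i)))        ≡⟨ ∑-*ʳ _ _ ⟩
  (∑ λ a → ind (P? a)) * (∑ λ v → ind (∀? λ i → P? (lookup v i)))      ≡⟨ cong ((∑ λ a → ind (P? a)) *_) (count-all P? m) ⟩
  (∑ λ a → ind (P? a)) ^ suc m                                         ∎
  where open ≡-Reasoning

-- Together with `≤size` the bridge from the given sizes to sums. Asking only for an implication
-- into a decidable `Q` lets the bad event, a negated existence statement, be measured by the
-- failure of a construction.
size≤ : {A : Set} {{_ : Finite A}} {P : A → Set} {Q : A → Set} (Q? : ∀ a → Dec (Q a)) →
        (∀ a → P a → Q a) → ∀ {m} → HasSize (Sub A P) m → m ≤ ∑ λ a → ind (Q? a)
size≤ {A} {P = P} {Q} Q? P⇒Q {m} e = begin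
  m                     ≡⟨ sym (card-Fin m) ⟩
  card (Fin m)          ≤⟨ ∑-inject (Sub.elem ∘ from) injective (λ _ → 1) (λ a → ind (Q? a)) (λ i → ≤-reflexive (sym (member (from i)))) ⟩
  (∑ λ a → ind (Q? a))  ∎
  where
  open ≤-Reasoning
  open Inverse e using (from; to; strictlyInverseˡ)
  elem-injective : (x y : Sub A P) → Sub.elem x ≡ Sub.elem y → x ≡ y
  elem-injective ⟨ a , _ ⟩ ⟨ .a , _ ⟩ refl = refl
  injective : ∀ i j → Sub.elem (from i) ≡ Sub.elem (from j) → i ≡ j
  injective i j eq = trans (sym (strictlyInverseˡ i)) (trans (cong to (elem-injective (from i) (from j) eq)) (strictlyInverseˡ j))
  member : (x : Sub A P) → ind (Q? (Sub.elem x)) ≡ 1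
  -- The stored proof is irrelevant; decidability of `Q` restores a usable one.
  member ⟨ a , p ⟩ = ind-yes (Q? a) (recompute (Q? a) (P⇒Q a p))

≤size : {A : Set} {{_ : Finite A}} {P : A → Set} {Q : A → Set} (Q? : ∀ a → Dec (Q a)) →
        (∀ a → Q a → P a) → ∀ {m} → HasSize (Sub A P) m → (∑ λ a → ind (Q? a)) ≤ m
≤size {A} {P = P} Q? Q⇒P {m} e = begin
  (∑ λ a → ind (Q? a))                                ≤⟨ ∑-mono (λ a → union-bound (Q? a) (λ i → Sub.elem (from i) ≟ a)
                                                           λ q → to ⟨ a , Q⇒P a q ⟩ , cong Sub.elem (strictlyInverseʳ ⟨ a , Q⇒P a q ⟩)) ⟩
  (∑ λ a → ∑ λ i → ind (Sub.elem (from i) ≟ a))       ≡⟨ ∑-swap _ ⟩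
  (∑ λ i → ∑ λ a → ind (Sub.elem (from i) ≟ a))       ≤⟨ ∑-bound (λ i → ∑-unique (λ a → Sub.elem (from i) ≟ a) λ a b e e′ → trans (sym e) e′) ⟩
  card (Fin m) * 1                                    ≡⟨ trans (*-identityʳ _) (card-Fin m) ⟩
  m                                                   ∎
  where
  open ≤-Reasoning
  open Inverse e using (from; to; strictlyInverseʳ)

nothing? : {A : Set} (x : Maybe A) → Dec (x ≡ nothing)
nothing? (just _) = no λ ()
nothing? nothing  = yes refl

-- Perfect matchings in dense bipartite graphs

transpose-left : ∀ {n} (i j : Fin n) → transpose i j ⟨$⟩ʳ i ≡ j
transpose-left i j rewrite dec-true (i Fin.≟ i) refl = refl

transpose-right : ∀ {n} (i j : Fin n) → transpose i j ⟨$⟩ʳ j ≡ i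
transpose-right i j with j Fin.≟ i
... | yes j≡i = j≡i
... | no _ rewrite dec-true (j Fin.≟ j) refl = refl

transpose-other : ∀ {n} {i j k : Fin n} → k ≢ i → k ≢ j → transpose i j ⟨$⟩ʳ k ≡ k
transpose-other {i = i} {j} {k} k≢i k≢j rewrite dec-false (k Fin.≟ i) k≢i | dec-false (k Fin.≟ j) k≢j = refl

module Exchange {n t : ℕ} (g : Fin n → Fin n → Set) (g? : ∀ k p → Dec (g k p))
  (columns : ∀ p → ∃ λ (I : Fin t → Fin n) → (∀ x y → I x ≡ I y → x ≡ y) × (∀ x → g (I x) p))
  (positions : ∀ k → ∃ λ (S : Fin t → Fin n) → (∀ x y → S x ≡ S y → x ≡ y) × (∀ x → g k (S x)))
  (dense : ∀ (C S : Fin t → Fin n) → (∀ x y → C x ≡ C y → x ≡ y) → (∀ x y → S x ≡ S y → x ≡ y) →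
           ∃₂ λ x y → g (C x) (S y))
  where

  -- If column k is badly served by π, rotate the entries of three columns k, c, i.
  improve : (π : Permutation′ n) (k : Fin n) →
            ∃ λ (π′ : Permutation′ n) → g k (π′ ⟨$⟩ʳ k) × (∀ x → g x (π ⟨$⟩ʳ x) → g x (π′ ⟨$⟩ʳ x))
  improve π k with g? k (π ⟨$⟩ʳ k)
  ... | yes good = π , good , λ _ h → h
  ... | no bad = rotate (c Fin.≟ i)
    where
    S = positions k
    I = columns (π ⟨$⟩ʳ k)
    π⁻¹-injective : ∀ {x y} → π ⟨$⟩ˡ x ≡ π ⟨$⟩ˡ y → x ≡ y
    π⁻¹-injective e = trans (sym (Perm.inverseʳ π)) (trans (cong (π ⟨$⟩ʳ_) e) (Perm.inverseʳ π))
    π-injective : ∀ {x y} → π ⟨$⟩ʳ x ≡ π ⟨$⟩ʳ y → x ≡ y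
    π-injective e = trans (sym (Perm.inverseˡ π)) (trans (cong (π ⟨$⟩ˡ_) e) (Perm.inverseˡ π))
    -- The candidates for `c` hold a position that `k` accepts; the candidates for `i` accept the
    -- position held by `k`. There are `t` of each, so density supplies `c` and `i` such that `c`
    -- accepts the entry of `i`, and the cycle k, c, i closes.
    edge = dense (λ x → π ⟨$⟩ˡ proj₁ S x) (λ y → π ⟨$⟩ʳ proj₁ I y)
                 (λ x y e → proj₁ (proj₂ S) x y (π⁻¹-injective e))
                 (λ x y e → proj₁ (proj₂ I) x y (π-injective e))
    c = π ⟨$⟩ˡ proj₁ S (proj₁ edge)
    i = proj₁ I (proj₁ (proj₂ edge))
    c→i : g c (π ⟨$⟩ʳ i)
    c→i = proj₂ (proj₂ edge)
    k→c : g k (π ⟨$⟩ʳ c)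
    k→c = subst (g k) (sym (Perm.inverseʳ π)) (proj₂ (proj₂ S) (proj₁ edge))
    i→k : g i (π ⟨$⟩ʳ k)
    i→k = proj₂ (proj₂ I) (proj₁ (proj₂ edge))
    k≢c : k ≢ c
    k≢c e = bad (subst (λ z → g k (π ⟨$⟩ʳ z)) (sym e) k→c)
    k≢i : k ≢ i
    k≢i e = bad (subst (λ z → g z (π ⟨$⟩ʳ k)) (sym e) i→k)
    rotate : Dec (c ≡ i) → ∃ λ π′ → g k (π′ ⟨$⟩ʳ k) × (∀ x → g x (π ⟨$⟩ʳ x) → g x (π′ ⟨$⟩ʳ x))
    -- If `c` and `i` coincide, the cycle has length two and a single swap serves both columns.
    rotate (yes c≡i) = transpose k c ∘ₚ π
      , subst (λ z → g k (π ⟨$⟩ʳ z)) (sym (transpose-left k c)) k→c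
      , keep
      where
      cases : ∀ x → Dec (x ≡ k) → Dec (x ≡ c) → g x (π ⟨$⟩ʳ x) → g x (π ⟨$⟩ʳ (transpose k c ⟨$⟩ʳ x))
      cases x (yes refl) _ h = contradiction h bad
      cases x (no _) (yes x≡c) h = subst₂ (λ y z → g y (π ⟨$⟩ʳ z)) (trans (sym c≡i) (sym x≡c))
        (sym (trans (cong (transpose k c ⟨$⟩ʳ_) x≡c) (transpose-right k c))) i→k
      cases x (no x≢k) (no x≢c) h = subst (λ z → g x (π ⟨$⟩ʳ z)) (sym (transpose-other x≢k x≢c)) h
      keep : ∀ x → g x (π ⟨$⟩ʳ x) → g x (π ⟨$⟩ʳ (transpose k c ⟨$⟩ʳ x))
      keep x = cases x (x Fin.≟ k) (x Fin.≟ c)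
    -- `transpose c i` acts first, so the composite sends k to c, c to i and i to k: each of the
    -- three takes an entry that it accepts, whether or not it was served before.
    rotate (no c≢i) = transpose c i ∘ₚ (transpose k c ∘ₚ π)
      , at k c (trans (cong τ (transpose-other k≢c k≢i)) (transpose-left k c)) k→c
      , keep
      where
      τ = transpose k c ⟨$⟩ʳ_
      σ = transpose c i ⟨$⟩ʳ_
      at : ∀ x y → τ (σ x) ≡ y → g x (π ⟨$⟩ʳ y) → g x (π ⟨$⟩ʳ τ (σ x))
      at x y e h = subst (λ z → g x (π ⟨$⟩ʳ z)) (sym e) h
      cases : ∀ x → Dec (x ≡ k) → Dec (x ≡ c) → Dec (x ≡ i) → g x (π ⟨$⟩ʳ x) → g x (π ⟨$⟩ʳ τ (σ x))
      cases x (yes refl) _ _ h = contradiction h bad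
      cases x (no _) (yes x≡c) _ h = subst (λ x → g x (π ⟨$⟩ʳ τ (σ x))) (sym x≡c)
        (at c i (trans (cong τ (transpose-left c i)) (transpose-other (λ e → k≢i (sym e)) (λ e → c≢i (sym e)))) c→i)
      cases x (no _) (no _) (yes x≡i) h = subst (λ x → g x (π ⟨$⟩ʳ τ (σ x))) (sym x≡i)
        (at i k (trans (cong τ (transpose-right c i)) (transpose-right k c)) i→k)
      cases x (no x≢k) (no x≢c) (no x≢i) h =
        at x x (trans (cong τ (transpose-other x≢c x≢i)) (transpose-other x≢k x≢c)) h
      keep : ∀ x → g x (π ⟨$⟩ʳ x) → g x (π ⟨$⟩ʳ τ (σ x))
      keep x = cases x (x Fin.≟ k) (x Fin.≟ c) (x Fin.≟ i)

  perfect-matching : ∃ λ (π : Permutation′ n) → ∀ k → g k (π ⟨$⟩ʳ k)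
  perfect-matching = let (π , h) = upTo n ≤-refl in π , λ k → h k (Fin.toℕ<n k)
    where
    upTo : ∀ j → j ≤ n → ∃ λ (π : Permutation′ n) → ∀ k → toℕ k < j → g k (π ⟨$⟩ʳ k)
    upTo zero    _   = Perm.id , λ _ ()
    upTo (suc j) j<n with upTo j (<⇒≤ j<n)
    ... | π , h with improve π (fromℕ< j<n)
    ... | π′ , new , keep = π′ , served
      where
      served : ∀ k → toℕ k < suc j → g k (π′ ⟨$⟩ʳ k)
      served k (s≤s k≤j) with toℕ k ℕ.≟ j
      ... | yes refl = subst (λ z → g z (π′ ⟨$⟩ʳ z)) (Fin.fromℕ<-toℕ k j<n) new
      ... | no k≢j = keep k (h k (≤∧≢⇒< k≤j k≢j))

-- Elementary estimates

binary-magnitude : ∀ n → 1 ≤ n → ∃ λ u → 2 ^ u ≤ n × n < 2 ^ suc u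
binary-magnitude (suc zero)    _ = 0 , ≤-refl , s≤s (s≤s z≤n)
binary-magnitude (suc (suc n)) _ with binary-magnitude (suc n) (s≤s z≤n)
... | u , lower , upper with suc (suc n) <? 2 ^ suc u
...   | yes small = u , ≤-trans lower (n≤1+n _) , small
...   | no large  = suc u , ≮⇒≥ large , ≤-<-trans upper (^-monoʳ-< 2 (s≤s (s≤s z≤n)) (n<1+n (suc u)))

-- The constant 41 is 30 + 11: with v = u + 1 and s = 5 v, the room s + gap required by the final
-- choice of parameters is 30 v² + 11 v. The base case is checked by evaluation.
square≤exponential : ∀ {u} → 14 ≤′ u → 41 * (suc u * suc u) ≤ 2 ^ u
square≤exponential ≤′-refl = ≤ᵇ⇒≤ _ _ tt
square≤exponential (≤′-step {u} 14≤u) = begin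
  41 * (suc (suc u) * suc (suc u))                   ≤⟨ m≤m+n _ 82 ⟩
  41 * (suc (suc u) * suc (suc u)) + 82              ≡⟨ expand u ⟩
  41 * (suc u * suc u + 1 + (2 * u + 4))             ≤⟨ *-monoʳ-≤ 41 (+-monoʳ-≤ (suc u * suc u + 1) (+-monoʳ-≤ (2 * u) (≤-trans (≤ᵇ⇒≤ 4 14 tt) (≤′⇒≤ 14≤u)))) ⟩
  41 * (suc u * suc u + 1 + (2 * u + u))             ≤⟨ *-monoʳ-≤ 41 (≤-trans (≤-reflexive (regroup u)) (+-monoʳ-≤ (suc u * suc u) (+-monoʳ-≤ 1 (*-monoˡ-≤ u (≤-trans (≤ᵇ⇒≤ 3 14 tt) (≤-trans (≤′⇒≤ 14≤u) (m≤n+m u 2))))))) ⟩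
  41 * (suc u * suc u + (1 + (2 + u) * u))           ≡⟨ double u ⟩
  2 * (41 * (suc u * suc u))                         ≤⟨ *-monoʳ-≤ 2 (square≤exponential 14≤u) ⟩
  2 * 2 ^ u                                          ∎
  where
  open ≤-Reasoning
  expand : ∀ u → 41 * (suc (suc u) * suc (suc u)) + 82 ≡ 41 * (suc u * suc u + 1 + (2 * u + 4))
  expand = solve-∀
  regroup : ∀ u → suc u * suc u + 1 + (2 * u + u) ≡ suc u * suc u + (1 + 3 * u)
  regroup = solve-∀
  double : ∀ u → 41 * (suc u * suc u + (1 + (2 + u) * u)) ≡ 2 * (41 * (suc u * suc u))
  double = solve-∀

field-size : ∀ {q} → FiniteField q → ∃ λ p → q ≡ suc (suc p)
field-size {zero}        F with () ← FiniteField.0# F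
field-size {suc zero}    F = contradiction (unique (FiniteField.0# F) (FiniteField.1# F)) (FiniteField.0≢1 F)
  where
  unique : (a b : Fin 1) → a ≡ b
  unique zero zero = refl
field-size {suc (suc p)} F = p , refl

module OverField {q : ℕ} (F : FiniteField q) where
  open FiniteField F renaming (_+_ to _⊕_; _*_ to _⊗_; -_ to ⊖_)
  open LinAlg F

  -- Linear algebra

  field-ring : CommutativeRing 0ℓ 0ℓ
  field-ring = record { isCommutativeRing = isCommutativeRing }

  module R = CommutativeRing field-ring
  module RP = RingProperties R.ring

  -v_ : ∀ {n} → Vector n → Vector n
  -v_ = map ⊖_

  vector-group : ℕ → AbelianGroup 0ℓ 0ℓ
  vector-group n = record
    { Carrier = Vector n ; _≈_ = _≡_ ; _∙_ = _+v_ ; ε = 0v ; _⁻¹ = -v_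
    ; isAbelianGroup = record
      { isGroup = record
        { isMonoid = record
          { isSemigroup = record
            { isMagma = record { isEquivalence = isEquivalence ; ∙-cong = cong₂ _+v_ }
            ; assoc = Vec.zipWith-assoc R.+-assoc }
          ; identity = Vec.zipWith-identityˡ R.+-identityˡ , Vec.zipWith-identityʳ R.+-identityʳ }
        ; inverse = Vec.zipWith-inverseˡ R.-‿inverseˡ , Vec.zipWith-inverseʳ R.-‿inverseʳ
        ; ⁻¹-cong = cong -v_ }
      ; comm = Vec.zipWith-comm R.+-comm } }

  module G {n} = AbelianGroup (vector-group n)
  module GP {n} = GroupProperties (vector-group n)

  _-v_ : ∀ {n} → Vector n → Vector n → Vector n
  u -v v = u +v (-v v)

  +v-cancelʳ : ∀ {n} (u x y : Vector n) → x +v u ≡ y +v u → x ≡ y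
  +v-cancelʳ = GP.∙-cancelʳ

  -v+v : ∀ {n} (x u : Vector n) → (x -v u) +v u ≡ x
  -v+v x u = trans (G.assoc x (-v u) u) (trans (cong (x +v_) (G.inverseˡ u)) (G.identityʳ x))

  dot : ∀ {n} → Vector n → Vector n → K
  dot []       []       = 0#
  dot (a ∷ u) (b ∷ v) = (a ⊗ b) ⊕ dot u v

  dot-comm : ∀ {n} (u v : Vector n) → dot u v ≡ dot v u
  dot-comm []      []      = refl
  dot-comm (a ∷ u) (b ∷ v) = cong₂ _⊕_ (R.*-comm a b) (dot-comm u v)

  ⊕-interchange : ∀ a b c d → (a ⊕ b) ⊕ (c ⊕ d) ≡ (a ⊕ c) ⊕ (b ⊕ d)
  ⊕-interchange a b c d = begin
    (a ⊕ b) ⊕ (c ⊕ d)  ≡⟨ R.+-assoc a b (c ⊕ d) ⟩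
    a ⊕ (b ⊕ (c ⊕ d))  ≡⟨ cong (a ⊕_) (sym (R.+-assoc b c d)) ⟩
    a ⊕ ((b ⊕ c) ⊕ d)  ≡⟨ cong (λ z → a ⊕ (z ⊕ d)) (R.+-comm b c) ⟩
    a ⊕ ((c ⊕ b) ⊕ d)  ≡⟨ cong (a ⊕_) (R.+-assoc c b d) ⟩
    a ⊕ (c ⊕ (b ⊕ d))  ≡⟨ sym (R.+-assoc a c (b ⊕ d)) ⟩
    (a ⊕ c) ⊕ (b ⊕ d)  ∎
    where open ≡-Reasoning

  dot-+ˡ : ∀ {n} (u v w : Vector n) → dot (u +v v) w ≡ dot u w ⊕ dot v w
  dot-+ˡ []      []      []      = sym (R.+-identityˡ 0#)
  dot-+ˡ (a ∷ u) (b ∷ v) (c ∷ w) =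
    trans (cong₂ _⊕_ (R.distribʳ c a b) (dot-+ˡ u v w)) (⊕-interchange _ _ _ _)

  dot-+ʳ : ∀ {n} (u v w : Vector n) → dot u (v +v w) ≡ dot u v ⊕ dot u w
  dot-+ʳ u v w = trans (dot-comm u (v +v w)) (trans (dot-+ˡ v w u) (cong₂ _⊕_ (dot-comm v u) (dot-comm w u)))

  dot-·ˡ : ∀ {n} (a : K) (u v : Vector n) → dot (a ·v u) v ≡ a ⊗ dot u v
  dot-·ˡ a []      []      = sym (R.zeroʳ a)
  dot-·ˡ a (b ∷ u) (c ∷ v) =
    trans (cong₂ _⊕_ (R.*-assoc a b c) (dot-·ˡ a u v)) (sym (R.distribˡ a (b ⊗ c) (dot u v)))

  dot-·ʳ : ∀ {n} (a : K) (u v : Vector n) → dot u (a ·v v) ≡ a ⊗ dot u v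
  dot-·ʳ a u v = trans (dot-comm u (a ·v v)) (trans (dot-·ˡ a v u) (cong (a ⊗_) (dot-comm v u)))

  dot-0ˡ : ∀ {n} (v : Vector n) → dot 0v v ≡ 0#
  dot-0ˡ []      = refl
  dot-0ˡ (a ∷ v) = trans (cong₂ _⊕_ (R.zeroˡ a) (dot-0ˡ v)) (R.+-identityˡ 0#)

  dot-0ʳ : ∀ {n} (v : Vector n) → dot v 0v ≡ 0#
  dot-0ʳ v = trans (dot-comm v 0v) (dot-0ˡ v)

  dot-negʳ : ∀ {n} (u v : Vector n) → dot u (-v v) ≡ ⊖ dot u v
  dot-negʳ []      []      = sym RP.-0#≈0#
  dot-negʳ (a ∷ u) (b ∷ v) = trans (cong₂ _⊕_ (sym (RP.-‿distribʳ-* a b)) (dot-negʳ u v)) (RP.-‿+-comm (a ⊗ b) (dot u v))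

  dot-minusʳ-0 : ∀ {n} (f u v : Vector n) → dot f u ≡ dot f v → dot f (u -v v) ≡ 0#
  dot-minusʳ-0 f u v e = trans (dot-+ʳ f u (-v v)) (trans (cong₂ _⊕_ e (dot-negʳ f v)) (R.-‿inverseʳ (dot f v)))

  dot-unit : ∀ {n} (f : Vector n) → f ≢ 0v → ∃ λ u → dot f u ≡ 1#
  dot-unit []      f≢0 = contradiction refl f≢0
  dot-unit (a ∷ f) f≢0 with a ≟ 0#
  ... | no a≢0 = let (b , ab) = inverse a a≢0 in
    b ∷ 0v , trans (cong₂ _⊕_ ab (dot-0ʳ f)) (R.+-identityʳ 1#)
  ... | yes refl = let (u , fu) = dot-unit f (λ eq → f≢0 (cong (0# ∷_) eq)) in
    0# ∷ u , trans (cong₂ _⊕_ (R.zeroˡ 0#) fu) (R.+-identityˡ 1#)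

  ·v-+ : ∀ {n} (a b : K) (v : Vector n) → (a ⊕ b) ·v v ≡ (a ·v v) +v (b ·v v)
  ·v-+ a b []      = refl
  ·v-+ a b (c ∷ v) = cong₂ _∷_ (R.distribʳ c a b) (·v-+ a b v)

  ·v-neg : ∀ {n} (a : K) (v : Vector n) → (⊖ a) ·v v ≡ -v (a ·v v)
  ·v-neg a []      = refl
  ·v-neg a (c ∷ v) = cong₂ _∷_ (sym (RP.-‿distribˡ-* a c)) (·v-neg a v)

  ·v-0ˡ : ∀ {n} (v : Vector n) → 0# ·v v ≡ 0v
  ·v-0ˡ []      = refl
  ·v-0ˡ (a ∷ v) = cong₂ _∷_ (R.zeroˡ a) (·v-0ˡ v)

  ·v-1 : ∀ {n} (v : Vector n) → 1# ·v v ≡ v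
  ·v-1 []      = refl
  ·v-1 (a ∷ v) = cong₂ _∷_ (R.*-identityˡ a) (·v-1 v)

  ·v-· : ∀ {n} (a b : K) (v : Vector n) → (a ⊗ b) ·v v ≡ a ·v (b ·v v)
  ·v-· a b []      = refl
  ·v-· a b (c ∷ v) = cong₂ _∷_ (R.*-assoc a b c) (·v-· a b v)

  ·v-distrib : ∀ {n} (a : K) (u v : Vector n) → a ·v (u +v v) ≡ (a ·v u) +v (a ·v v)
  ·v-distrib a []      []      = refl
  ·v-distrib a (b ∷ u) (c ∷ v) = cong₂ _∷_ (R.distribˡ a b c) (·v-distrib a u v)

  ·v-0ʳ : ∀ {n} (a : K) → a ·v 0v {n} ≡ 0v
  ·v-0ʳ {zero}  a = refl
  ·v-0ʳ {suc n} a = cong₂ _∷_ (R.zeroʳ a) (·v-0ʳ a)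

  ·v-nonzero : ∀ {n} {a : K} {v : Vector n} → a ≢ 0# → v ≢ 0v → a ·v v ≢ 0v
  ·v-nonzero {a = a} {v} a≢0 v≢0 eq = let (b , ab) = inverse a a≢0 in v≢0 (begin
    v                ≡⟨ sym (·v-1 v) ⟩
    1# ·v v          ≡⟨ cong (_·v v) (sym (trans (R.*-comm b a) ab)) ⟩
    (b ⊗ a) ·v v     ≡⟨ ·v-· b a v ⟩
    b ·v (a ·v v)    ≡⟨ cong (b ·v_) eq ⟩
    b ·v 0v          ≡⟨ ·v-0ʳ b ⟩
    0v               ∎)
    where open ≡-Reasoning

  +v-interchange : ∀ {n} (a b c d : Vector n) → (a +v b) +v (c +v d) ≡ (a +v c) +v (b +v d)
  +v-interchange []      []      []      []      = refl
  +v-interchange (a ∷ u) (b ∷ v) (c ∷ w) (d ∷ x) = cong₂ _∷_ (⊕-interchange a b c d) (+v-interchange u v w x)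

  lincomb-+ : ∀ {n m} (c d : Vec K m) (vs : Vec (Vector n) m) →
              lincomb (c +v d) vs ≡ lincomb c vs +v lincomb d vs
  lincomb-+ []      []      []       = sym (G.identityˡ 0v)
  lincomb-+ (a ∷ c) (b ∷ d) (v ∷ vs) =
    trans (cong₂ _+v_ (·v-+ a b v) (lincomb-+ c d vs)) (+v-interchange _ _ _ _)

  lincomb-neg : ∀ {n m} (c : Vec K m) (vs : Vec (Vector n) m) → lincomb (-v c) vs ≡ -v lincomb c vs
  lincomb-neg []      []       = sym GP.ε⁻¹≈ε
  lincomb-neg (a ∷ c) (v ∷ vs) =
    trans (cong₂ _+v_ (·v-neg a v) (lincomb-neg c vs)) (GP.⁻¹-∙-comm (a ·v v) (lincomb c vs))

  lincomb-minus : ∀ {n m} (c d : Vec K m) (vs : Vec (Vector n) m) →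
                  lincomb (c -v d) vs ≡ lincomb c vs -v lincomb d vs
  lincomb-minus c d vs = trans (lincomb-+ c (-v d) vs) (cong (lincomb c vs +v_) (lincomb-neg d vs))

  lincomb-· : ∀ {n m} (a : K) (c : Vec K m) (vs : Vec (Vector n) m) →
              lincomb (a ·v c) vs ≡ a ·v lincomb c vs
  lincomb-· a []      []       = sym (·v-0ʳ a)
  lincomb-· a (b ∷ c) (v ∷ vs) =
    trans (cong₂ _+v_ (·v-· a b v) (lincomb-· a c vs)) (sym (·v-distrib a (b ·v v) (lincomb c vs)))

  lincomb-0 : ∀ {n m} (vs : Vec (Vector n) m) → lincomb 0v vs ≡ 0v
  lincomb-0 []       = refl
  lincomb-0 (v ∷ vs) = trans (cong₂ _+v_ (·v-0ˡ v) (lincomb-0 vs)) (G.identityˡ 0v)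

  dots : ∀ {n m} → Vec (Vector n) m → Vector n → Vector m
  dots vs x = map (λ v → dot v x) vs

  dot-lincomb : ∀ {n m} (c : Vec K m) (vs : Vec (Vector n) m) (x : Vector n) →
                dot (lincomb c vs) x ≡ dot c (dots vs x)
  dot-lincomb []      []       x = dot-0ˡ x
  dot-lincomb (a ∷ c) (v ∷ vs) x =
    trans (dot-+ˡ (a ·v v) (lincomb c vs) x) (cong₂ _⊕_ (dot-·ˡ a v x) (dot-lincomb c vs x))

  minus-0 : ∀ {n} (u v : Vector n) → u -v v ≡ 0v → u ≡ v
  minus-0 u v e = trans (sym (-v+v u v)) (trans (cong (_+v v) e) (G.identityˡ v))

  lincomb-injective : ∀ {n m} {vs : Vec (Vector n) m} → LinearlyIndependent vs →
                      ∀ c d → lincomb c vs ≡ lincomb d vs → c ≡ d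
  lincomb-injective {vs = vs} li c d e = minus-0 c d (li (c -v d)
    (trans (lincomb-minus c d vs) (trans (cong (_-v lincomb d vs) e) (G.inverseʳ (lincomb d vs)))))

  Span : ∀ {n m} → Vec (Vector n) m → Vector n → Set
  Span vs v = ∃ λ c → lincomb c vs ≡ v

  span? : ∀ {n m} (vs : Vec (Vector n) m) v → Dec (Span vs v)
  span? vs v = ∃? λ c → lincomb c vs ≟ v

  independent? : ∀ {n m} (vs : Vec (Vector n) m) → Dec (LinearlyIndependent vs)
  independent? vs = map′ (λ h c e → decidable-stable (c ≟ 0v) λ c≢0 → h (c , e , c≢0))
                         (λ h (c , e , c≢0) → c≢0 (h c e))
                         (¬? (∃? λ c → (lincomb c vs ≟ 0v) ×-dec ¬? (c ≟ 0v)))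

  independent-tail : ∀ {n m} {v : Vector n} {vs : Vec (Vector n) m} →
                     LinearlyIndependent (v ∷ vs) → LinearlyIndependent vs
  independent-tail {v = v} li c e = Vec.∷-injectiveʳ
    (li (0# ∷ c) (trans (cong₂ _+v_ (·v-0ˡ v) e) (G.identityˡ 0v)))

  independent-∉ : ∀ {n m} {v : Vector n} {vs : Vec (Vector n) m} →
                  LinearlyIndependent (v ∷ vs) → ¬ Span vs v
  independent-∉ {v = v} {vs} li (c , e) = 0≢1 (sym (Vec.∷-injectiveˡ (li (1# ∷ -v c)
    (trans (cong₂ _+v_ (·v-1 v) (trans (lincomb-neg c vs) (cong -v_ e))) (G.inverseʳ v)))))

  independent-∷ : ∀ {n m} {v : Vector n} {vs : Vec (Vector n) m} →
                  LinearlyIndependent vs → ¬ Span vs v → LinearlyIndependent (v ∷ vs)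
  independent-∷ {v = v} {vs} li v∉ (a ∷ c) e with a ≟ 0#
  ... | yes refl = cong (0# ∷_) (li c (trans (sym (G.identityˡ _)) (trans (cong (_+v lincomb c vs) (sym (·v-0ˡ v))) e)))
  ... | no a≢0 = contradiction (b ·v (-v c) , (begin
      lincomb (b ·v (-v c)) vs     ≡⟨ lincomb-· b (-v c) vs ⟩
      b ·v lincomb (-v c) vs       ≡⟨ cong (b ·v_) (lincomb-neg c vs) ⟩
      b ·v (-v lincomb c vs)       ≡⟨ cong (b ·v_) (sym (GP.inverseˡ-unique (a ·v v) (lincomb c vs) e)) ⟩
      b ·v (a ·v v)                ≡⟨ sym (·v-· b a v) ⟩
      (b ⊗ a) ·v v                 ≡⟨ cong (_·v v) (trans (R.*-comm b a) (proj₂ (inverse a a≢0))) ⟩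
      1# ·v v                      ≡⟨ ·v-1 v ⟩
      v                            ∎)) v∉
      where open ≡-Reasoning
            b = proj₁ (inverse a a≢0)

  -- A functional vanishing on vs but not on v certifies that v ∉ span vs.
  independent-extend : ∀ {n m} (f : Vector n) {v : Vector n} {vs : Vec (Vector n) m} →
                       LinearlyIndependent vs → (dots vs f ≡ 0v) → dot f v ≢ 0# →
                       LinearlyIndependent (v ∷ vs)
  independent-extend f {v} {vs} li f⊥ fv≢0 = independent-∷ li λ (c , e) → fv≢0 (begin
    dot f v                ≡⟨ dot-comm f v ⟩
    dot v f                ≡⟨ cong (λ w → dot w f) (sym e) ⟩
    dot (lincomb c vs) f   ≡⟨ dot-lincomb c vs f ⟩
    dot c (dots vs f)      ≡⟨ cong (dot c) f⊥ ⟩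
    dot c 0v               ≡⟨ dot-0ʳ c ⟩
    0#                     ∎)
    where open ≡-Reasoning

  -- Counting vectors

  q≥2 : 2 ≤ q
  q≥2 with p , refl ← field-size F = s≤s (s≤s z≤n)

  instance
    q-nonZero : NonZero q
    q-nonZero = >-nonZero (≤-trans (s≤s z≤n) q≥2)

  card-K : card K ≡ q
  card-K = card-Fin q

  card-Vector : ∀ n → card (Vector n) ≡ q ^ n
  card-Vector n = trans (card-Vec n) (cong (_^ n) card-K)

  size : ∀ {n} {P : Vector n → Set} → (∀ x → Dec (P x)) → ℕ
  size P? = ∑ λ x → ind (P? x)

  size-complement : ∀ {n} {P : Vector n → Set} (P? : ∀ x → Dec (P x)) → size P? + size (λ x → ¬? (P? x)) ≡ q ^ n
  size-complement {n} P? = trans (sym (∑-+ (λ x → ind (P? x)) (λ x → ind (¬? (P? x)))))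
    (trans (∑-cong λ x → ind-¬ (P? x)) (card-Vector n))

  size-translate : ∀ {n} {P Q : Vector n → Set} (P? : ∀ x → Dec (P x)) (Q? : ∀ x → Dec (Q x)) (u : Vector n) →
                   (∀ x → P x → Q (x +v u)) → size P? ≤ size Q?
  size-translate P? Q? u h = ∑-inject (_+v u) (+v-cancelʳ u) _ _ λ x → ind-mono (P? x) (Q? (x +v u)) (h x)

  -- Translation by `a ·v u`, where `dot f u` is 1, identifies the zero set of `f` with each of its
  -- q level sets, and these partition the space.
  hyperplane : ∀ {n} (f : Vector n) → f ≢ 0v → q * size (λ x → dot f x ≟ 0#) ≡ q ^ n
  hyperplane {n} f f≢0 = begin
    q * size (λ x → dot f x ≟ 0#)                  ≡⟨ cong (_* size (λ x → dot f x ≟ 0#)) (sym card-K) ⟩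
    card K * size (λ x → dot f x ≟ 0#)             ≡⟨ sym (∑-const {K} _) ⟩
    ∑ {K} (λ a → size (λ x → dot f x ≟ 0#))        ≡⟨ ∑-cong {K} (λ a → ≤-antisym
      (size-translate _ _ (a ·v u) (λ x e → trans (dot-+ʳ f x (a ·v u)) (trans (cong₂ _⊕_ e (f·au a)) (R.+-identityˡ a))))
      (size-translate _ _ (-v (a ·v u)) (λ x e → dot-minusʳ-0 f x (a ·v u) (trans e (sym (f·au a)))))) ⟩
    ∑ {K} (λ a → size (λ x → dot f x ≟ a))         ≡⟨ ∑-swap (λ a x → ind (dot f x ≟ a)) ⟩
    ∑ (λ x → ∑ λ a → ind (dot f x ≟ a))            ≡⟨ ∑-cong (λ x → trans (∑-cong λ a → ind-≡ (dot f x ≟ a) (a ≟ dot f x) sym sym) (∑-δ (dot f x))) ⟩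
    card (Vector n)                                ≡⟨ card-Vector n ⟩
    q ^ n                                          ∎
    where
    open ≡-Reasoning
    u = proj₁ (dot-unit f f≢0)
    f·au : ∀ a → dot f (a ·v u) ≡ a
    f·au a = trans (dot-·ʳ a f u) (trans (cong (a ⊗_) (proj₂ (dot-unit f f≢0))) (R.*-identityʳ a))

  -- Both cases in one equation without subtraction, so that it can be summed over families in which
  -- some functionals are zero.
  hyperplane-or-all : ∀ {n} (f : Vector n) →
                      q * size (λ x → dot f x ≟ 0#) + ind (f ≟ 0v) * q ^ n ≡ q ^ n + ind (f ≟ 0v) * (q * q ^ n)
  hyperplane-or-all {n} f with f ≟ 0v
  ... | no f≢0   = cong (_+ 0) (hyperplane f f≢0)
  ... | yes refl = trans (cong (λ z → q * z + 1 * q ^ n) (trans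
      (∑-cong λ x → ind-yes (dot 0v x ≟ 0#) (dot-0ˡ x)) (card-Vector n)))
      (rearrange q (q ^ n))
    where
    rearrange : ∀ a b → a * b + 1 * b ≡ b + 1 * (a * b)
    rearrange = solve-∀

  -- Counting the pairs (a, b) with (Σ aⱼ fⱼ) · b = 0 in both orders.
  annihilator-size : ∀ {n s} (fs : Vec (Vector n) s) → LinearlyIndependent fs →
                     size (λ b → dots fs b ≟ 0v) * q ^ s ≡ q ^ n
  annihilator-size {n} {s} fs li = solution (q≥2) (q ^ s) (q ^ n) W pairs eq₁ eq₂
    where
    W = size (λ b → dots fs b ≟ 0v)
    pairs = ∑ λ (b : Vector n) → ∑ λ (a : Vector s) → ind (dot a (dots fs b) ≟ 0#)
    pairs′ = ∑ λ (a : Vector s) → ∑ λ (b : Vector n) → ind (dot (lincomb a fs) b ≟ 0#)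
    pairs≡ : pairs ≡ pairs′
    pairs≡ = trans (∑-swap (λ b a → ind (dot a (dots fs b) ≟ 0#)))
      (∑-cong λ a → ∑-cong λ b → cong (λ z → ind (z ≟ 0#)) (sym (dot-lincomb a fs b)))
    total-over : ∀ {A : Set} {{_ : Finite A}} {m} (g : A → Vector m) →
      q * (∑ λ x → size (λ y → dot (g x) y ≟ 0#)) + (∑ λ x → ind (g x ≟ 0v)) * q ^ m
        ≡ card A * q ^ m + (∑ λ x → ind (g x ≟ 0v)) * (q * q ^ m)
    total-over {m = m} g = begin
      q * (∑ λ x → size (λ y → dot (g x) y ≟ 0#)) + (∑ λ x → ind (g x ≟ 0v)) * q ^ m
        ≡⟨ cong₂ _+_ (sym (∑-*ˡ q _)) (sym (∑-*ʳ _ (q ^ m))) ⟩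
      (∑ λ x → q * size (λ y → dot (g x) y ≟ 0#)) + (∑ λ x → ind (g x ≟ 0v) * q ^ m)
        ≡⟨ sym (∑-+ _ _) ⟩
      (∑ λ x → q * size (λ y → dot (g x) y ≟ 0#) + ind (g x ≟ 0v) * q ^ m)
        ≡⟨ ∑-cong (λ x → hyperplane-or-all (g x)) ⟩
      (∑ λ x → q ^ m + ind (g x ≟ 0v) * (q * q ^ m))
        ≡⟨ ∑-+ _ _ ⟩
      (∑ λ x → q ^ m) + (∑ λ x → ind (g x ≟ 0v) * (q * q ^ m))
        ≡⟨ cong₂ _+_ (∑-const (q ^ m)) (∑-*ʳ _ (q * q ^ m)) ⟩
      card _ * q ^ m + (∑ λ x → ind (g x ≟ 0v)) * (q * q ^ m) ∎
      where open ≡-Reasoning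
    eq₁ : q * pairs + W * q ^ s ≡ q ^ n * q ^ s + W * (q * q ^ s)
    eq₁ = begin
      q * pairs + W * q ^ s ≡⟨ cong (λ z → q * z + W * q ^ s) (∑-cong λ b → ∑-cong λ a → cong (λ z → ind (z ≟ 0#)) (dot-comm a (dots fs b))) ⟩
      q * (∑ λ b → size (λ a → dot (dots fs b) a ≟ 0#)) + W * q ^ s ≡⟨ total-over (dots fs) ⟩
      card (Vector n) * q ^ s + W * (q * q ^ s) ≡⟨ cong (λ z → z * q ^ s + W * (q * q ^ s)) (card-Vector n) ⟩
      q ^ n * q ^ s + W * (q * q ^ s) ∎
      where open ≡-Reasoning
    one-zero : (∑ λ a → ind (lincomb a fs ≟ 0v)) ≡ 1
    one-zero = trans (∑-cong λ a → ind-≡ (lincomb a fs ≟ 0v) (a ≟ 0v) (li a) (λ { refl → lincomb-0 fs })) (∑-δ 0v)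
    eq₂ : q * pairs + q ^ n ≡ q ^ s * q ^ n + q * q ^ n
    eq₂ = begin
      q * pairs + q ^ n ≡⟨ cong₂ (λ y z → q * y + z) pairs≡ (sym (*-identityˡ (q ^ n))) ⟩
      q * pairs′ + 1 * q ^ n ≡⟨ cong (λ z → q * pairs′ + z * q ^ n) (sym one-zero) ⟩
      q * pairs′ + (∑ λ a → ind (lincomb a fs ≟ 0v)) * q ^ n ≡⟨ total-over (λ a → lincomb a fs) ⟩
      card (Vector s) * q ^ n + (∑ λ a → ind (lincomb a fs ≟ 0v)) * (q * q ^ n)
        ≡⟨ cong₂ (λ y z → y * q ^ n + z * (q * q ^ n)) (card-Vector s) one-zero ⟩
      q ^ s * q ^ n + 1 * (q * q ^ n) ≡⟨ cong (q ^ s * q ^ n +_) (*-identityˡ (q * q ^ n)) ⟩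
      q ^ s * q ^ n + q * q ^ n ∎
      where open ≡-Reasoning
    -- Both equations contain `q * P`. Eliminating it gives (q - 1) W S = (q - 1) N, and q ≥ 2
    -- allows the cancellation.
    solution : ∀ {q} → 2 ≤ q → ∀ S N W P → q * P + W * S ≡ N * S + W * (q * S) → q * P + N ≡ S * N + q * N → W * S ≡ N
    solution {suc (suc p)} (s≤s (s≤s _)) S N W P e₁ e₂ = *-cancelˡ-≡ (W * S) N (suc p)
      (+-cancelˡ-≡ (N * S + W * S + N) _ _ (begin
        (N * S + W * S + N) + suc p * (W * S)   ≡⟨ r₁ p S N W ⟩
        (N * S + W * (suc (suc p) * S)) + N     ≡⟨ cong (_+ N) (sym e₁) ⟩
        (suc (suc p) * P + W * S) + N           ≡⟨ r₂ (suc (suc p) * P) (W * S) N ⟩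
        (suc (suc p) * P + N) + W * S           ≡⟨ cong (_+ W * S) e₂ ⟩
        (S * N + suc (suc p) * N) + W * S       ≡⟨ r₃ p S N W ⟩
        (N * S + W * S + N) + suc p * N         ∎))
      where
      open ≡-Reasoning
      r₁ : ∀ p S N W → (N * S + W * S + N) + suc p * (W * S) ≡ (N * S + W * (suc (suc p) * S)) + N
      r₁ = solve-∀
      r₂ : ∀ a b c → (a + b) + c ≡ (a + c) + b
      r₂ = solve-∀
      r₃ : ∀ p S N W → (S * N + suc (suc p) * N) + W * S ≡ (N * S + W * S + N) + suc p * N
      r₃ = solve-∀

  -- Pigeonhole: if only zero were orthogonal to `vs`, then `dots vs` would be injective from a set
  -- of size qⁿ into one of size qⁱ. The vector itself is found by finite search.
  normal-exists : ∀ {n i} → i < n → (vs : Vec (Vector n) i) → ∃ λ f → f ≢ 0v × dots vs f ≡ 0v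
  normal-exists {n} {i} i<n vs with ∃? (λ f → ¬? (f ≟ 0v) ×-dec (dots vs f ≟ 0v))
  ... | yes (f , h) = f , h
  ... | no none = contradiction (begin
      q ^ n            ≡⟨ sym (card-Vector n) ⟩
      card (Vector n)  ≤⟨ ∑-inject (dots vs) injective (λ _ → 1) (λ _ → 1) (λ _ → ≤-refl) ⟩
      card (Vector i)  ≡⟨ card-Vector i ⟩
      q ^ i            ∎) (<⇒≱ (^-monoʳ-< q q≥2 i<n))
    where
    open ≤-Reasoning
    dots-minus : ∀ {m} (vs : Vec (Vector n) m) (x y : Vector n) → dots vs x ≡ dots vs y → dots vs (x -v y) ≡ 0v
    dots-minus []       x y e = refl
    dots-minus (v ∷ vs) x y e = cong₂ _∷_ (dot-minusʳ-0 v x y (Vec.∷-injectiveˡ e)) (dots-minus vs x y (Vec.∷-injectiveʳ e))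
    injective : ∀ x y → dots vs x ≡ dots vs y → x ≡ y
    injective x y e = minus-0 x y (decidable-stable (x -v y ≟ 0v) λ ≢0 → none (x -v y , ≢0 , dots-minus vs x y e))

  -- Independence makes the qⁿ combinations distinct; if they missed some `w`, they would have to
  -- fit into qⁿ - 1 vectors.
  independent⇒basis : ∀ {n} {vs : Vec (Vector n) n} → LinearlyIndependent vs → IsBasis vs
  independent⇒basis {n} {vs} li = li , λ w → decidable-stable (span? vs w) λ w∉ →
    contradiction (begin-strict
      q ^ n                                            ≡⟨ sym (card-Vector n) ⟩
      card (Vector n)                                  ≤⟨ ∑-inject (λ c → lincomb c vs) (lincomb-injective li) (λ _ → 1)
                                                            (λ y → ind (¬? (y ≟ w))) (λ c → ≤-reflexive (sym (ind-yes (¬? (lincomb c vs ≟ w)) λ e → w∉ (c , e)))) ⟩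
      size (λ y → ¬? (y ≟ w))                          <⟨ n<1+n _ ⟩
      1 + size (λ y → ¬? (y ≟ w))                      ≡⟨ cong (_+ size (λ y → ¬? (y ≟ w))) (sym (∑-δ w)) ⟩
      size (λ y → y ≟ w) + size (λ y → ¬? (y ≟ w))     ≡⟨ size-complement (_≟ w) ⟩
      q ^ n                                            ∎) (n≮n (q ^ n))
    where open ≤-Reasoning

  -- Additive subgroups and the sizes of spans

  record Subgroup {n} (P : Vector n → Set) : Set where
    field
      zero∈  : P 0v
      minus∈ : ∀ {x y} → P x → P y → P (x -v y)

  open Subgroup

  -v-cancelˡ : ∀ {n} (y u w : Vector n) → (y +v u) -v (y +v w) ≡ u -v w
  -v-cancelˡ y u w = begin
    (y +v u) +v (-v (y +v w))        ≡⟨ cong ((y +v u) +v_) (sym (GP.⁻¹-∙-comm y w)) ⟩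
    (y +v u) +v ((-v y) +v (-v w))   ≡⟨ +v-interchange y u (-v y) (-v w) ⟩
    (y -v y) +v (u -v w)             ≡⟨ trans (cong (_+v (u -v w)) (G.inverseʳ y)) (G.identityˡ _) ⟩
    u -v w                           ∎
    where open ≡-Reasoning

  -- Double counting of the pairs (y, u) with `u` in `U` and `y +v u` in `V`: every `u` allows at
  -- least as many `y` as `V` has elements, while the `u` belonging to a fixed `y` form the empty
  -- set or a coset of the intersection.
  subgroup-product : ∀ {n} {V U : Vector n → Set} (V? : ∀ x → Dec (V x)) (U? : ∀ x → Dec (U x)) →
                     Subgroup V → Subgroup U → size V? * size U? ≤ size (λ x → V? x ×-dec U? x) * q ^ n
  subgroup-product {n} {V} {U} V? U? sgV sgU = begin
    size V? * size U?                                            ≡⟨ sym (∑-*ˡ (size V?) _) ⟩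
    (∑ λ u → size V? * ind (U? u))                               ≤⟨ ∑-mono (λ u → *-monoˡ-≤ (ind (U? u)) (translate u)) ⟩
    (∑ λ u → size (λ y → V? (y +v u)) * ind (U? u))              ≡⟨ ∑-cong (λ u → sym (∑-*ʳ _ (ind (U? u)))) ⟩
    (∑ λ u → ∑ λ y → ind (V? (y +v u)) * ind (U? u))             ≡⟨ ∑-swap _ ⟩
    (∑ λ y → ∑ λ u → ind (V? (y +v u)) * ind (U? u))             ≡⟨ ∑-cong (λ y → ∑-cong λ u → sym (ind-× (V? (y +v u)) (U? u))) ⟩
    (∑ λ y → size λ u → V? (y +v u) ×-dec U? u)                  ≤⟨ ∑-bound fibre ⟩
    card (Vector n) * I                                          ≡⟨ trans (cong (_* I) (card-Vector n)) (*-comm (q ^ n) I) ⟩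
    I * q ^ n                                                    ∎
    where
    open ≤-Reasoning
    I = size (λ x → V? x ×-dec U? x)
    translate : ∀ u → size V? ≤ size (λ y → V? (y +v u))
    translate u = size-translate V? (λ y → V? (y +v u)) (-v u) λ x p → subst V (sym (-v+v x u)) p
    fibre : ∀ y → size (λ u → V? (y +v u) ×-dec U? u) ≤ I
    fibre y with ∃? (λ u → V? (y +v u) ×-dec U? u)
    ... | no none = ≤-trans (≤-reflexive (∑-cong λ u → ind-no (V? (y +v u) ×-dec U? u) λ p → none (u , p)))
                      (≤-trans (≤-reflexive (trans (∑-const 0) (*-zeroʳ (card (Vector n))))) z≤n)
    ... | yes (u₀ , v₀∈ , u₀∈) = size-translate _ _ (-v u₀) λ u (v∈ , u∈) →
          subst V (-v-cancelˡ y u u₀) (minus∈ sgV v∈ v₀∈) , minus∈ sgU u∈ u₀∈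

  span-subgroup : ∀ {n m} (vs : Vec (Vector n) m) → Subgroup (Span vs)
  span-subgroup vs = record
    { zero∈ = 0v , lincomb-0 vs
    ; minus∈ = λ { (c , refl) (d , refl) → (c -v d) , lincomb-minus c d vs } }

  span-size≤ : ∀ {n m} (vs : Vec (Vector n) m) → size (span? vs) ≤ q ^ m
  span-size≤ {n} {m} vs = begin
    size (span? vs)                               ≤⟨ ∑-mono (λ v → union-bound (span? vs v) (λ c → lincomb c vs ≟ v) λ p → p) ⟩
    (∑ λ v → ∑ λ c → ind (lincomb c vs ≟ v))      ≡⟨ ∑-swap (λ v c → ind (lincomb c vs ≟ v)) ⟩
    (∑ λ c → ∑ λ v → ind (lincomb c vs ≟ v))      ≤⟨ ∑-bound (λ c → ∑-unique (λ v → lincomb c vs ≟ v) λ x y e e′ → trans (sym e) e′) ⟩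
    card (Vec K m) * 1                            ≡⟨ trans (*-identityʳ _) (card-Vector m) ⟩
    q ^ m                                         ∎
    where open ≤-Reasoning

  span-size : ∀ {n m} {vs : Vec (Vector n) m} → LinearlyIndependent vs → size (span? vs) ≡ q ^ m
  span-size {n} {m} {vs} li = ≤-antisym (span-size≤ vs) (begin
    q ^ m             ≡⟨ sym (card-Vector m) ⟩
    card (Vector m)   ≤⟨ ∑-inject (λ c → lincomb c vs) (lincomb-injective li) (λ _ → 1) _ (λ c → ≤-reflexive (sym (ind-yes (span? vs (lincomb c vs)) (c , refl)))) ⟩
    size (span? vs)   ∎)
    where open ≤-Reasoning

  -- Random bases: the probability of a family of subspace constraints

  -- `codim` is a lower bound for the true codimension: `bound` says that a uniform vector satisfies
  -- the constraint with probability at most q to the -codim. Spans of possibly dependent vectors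
  -- therefore qualify too.
  record Constraint (n : ℕ) : Set₁ where
    field
      Holds    : Vector n → Set
      holds?   : ∀ x → Dec (Holds x)
      subgroup : Subgroup Holds
      codim    : ℕ
      bound    : size holds? * q ^ codim ≤ q ^ n

  open Constraint

  unconstrained : ∀ {n} → Constraint n
  unconstrained {n} = record
    { Holds = λ _ → ⊤ ; holds? = λ _ → yes tt
    ; subgroup = record { zero∈ = tt ; minus∈ = λ _ _ → tt }
    ; codim = 0
    ; bound = ≤-reflexive (trans (*-identityʳ _) (card-Vector n)) }

  #independent : ℕ → ℕ → ℕ
  #independent n j = ∑ λ (B : Vec (Vector n) j) → ind (independent? B)

  Satisfies : ∀ {n j} → (Fin j → Constraint n) → Vec (Vector n) j → Set
  Satisfies C B = LinearlyIndependent B × (∀ p → Holds (C p) (lookup B p))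

  satisfies? : ∀ {n j} (C : Fin j → Constraint n) B → Dec (Satisfies C B)
  satisfies? C B = independent? B ×-dec ∀? λ p → holds? (C p) (lookup B p)

  outside-count : ∀ {n j} {vs : Vec (Vector n) j} → LinearlyIndependent vs →
                  size (λ v → ¬? (span? vs v)) ≡ q ^ n ∸ q ^ j
  outside-count {n} {j} {vs} li = begin
    size (λ v → ¬? (span? vs v))                            ≡⟨ sym (m+n∸m≡n (q ^ j) _) ⟩
    q ^ j + size (λ v → ¬? (span? vs v)) ∸ q ^ j            ≡⟨ cong (λ z → z + size (λ v → ¬? (span? vs v)) ∸ q ^ j) (sym (span-size li)) ⟩
    size (span? vs) + size (λ v → ¬? (span? vs v)) ∸ q ^ j  ≡⟨ cong (_∸ q ^ j) (size-complement (span? vs)) ⟩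
    q ^ n ∸ q ^ j                                           ∎
    where open ≡-Reasoning

  -- The share of the constraint set can only shrink outside a span: with A, U, I the sizes of the
  -- constraint set, the span and their intersection, and N = qⁿ, `subgroup-product` gives A U ≤ I
  -- N, hence (A - I) N ≤ A (N - U).
  constrained-outside : ∀ {n j} (C : Constraint n) {vs : Vec (Vector n) j} → LinearlyIndependent vs →
                        size (λ v → holds? C v ×-dec ¬? (span? vs v)) * q ^ codim C ≤ q ^ n ∸ q ^ j
  constrained-outside {n} {j} C {vs} li = subst (X * q ^ codim C ≤_) (outside-count li)
    (*-cancelʳ-≤ (X * q ^ codim C) D (q ^ n) (begin
      X * c * N     ≡⟨ r₁ X c N ⟩
      (X * N) * c   ≤⟨ *-monoˡ-≤ c XN≤AD ⟩
      (A * D) * c   ≡⟨ r₂ A D c ⟩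
      D * (A * c)   ≤⟨ *-monoʳ-≤ D (bound C) ⟩
      D * N         ∎))
    where
    open ≤-Reasoning
    N = q ^ n
    c = q ^ codim C
    A = size (holds? C)
    I = size (λ v → holds? C v ×-dec span? vs v)
    X = size (λ v → holds? C v ×-dec ¬? (span? vs v))
    U = size (span? vs)
    D = size (λ v → ¬? (span? vs v))
    instance
      N≢0 : NonZero (q ^ n)
      N≢0 = m^n≢0 q n
    r₁ : ∀ a b c → a * b * c ≡ (a * c) * b
    r₁ = solve-∀
    r₂ : ∀ a b c → (a * b) * c ≡ b * (a * c)
    r₂ = solve-∀
    A≡ : A ≡ I + X
    A≡ = sym (trans (sym (∑-+ _ _)) (∑-cong λ v → begin-equality
      ind (holds? C v ×-dec span? vs v) + ind (holds? C v ×-dec ¬? (span? vs v))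
        ≡⟨ cong₂ _+_ (ind-× (holds? C v) (span? vs v)) (ind-× (holds? C v) (¬? (span? vs v))) ⟩
      ind (holds? C v) * ind (span? vs v) + ind (holds? C v) * ind (¬? (span? vs v))
        ≡⟨ sym (*-distribˡ-+ (ind (holds? C v)) _ _) ⟩
      ind (holds? C v) * (ind (span? vs v) + ind (¬? (span? vs v)))
        ≡⟨ cong (ind (holds? C v) *_) (ind-¬ (span? vs v)) ⟩
      ind (holds? C v) * 1 ≡⟨ *-identityʳ _ ⟩
      ind (holds? C v) ∎))
    XN≤AD : X * N ≤ A * D
    XN≤AD = +-cancelˡ-≤ (A * U) (X * N) (A * D) (begin
      A * U + X * N   ≤⟨ +-monoˡ-≤ (X * N) (subgroup-product (holds? C) (span? vs) (subgroup C) (span-subgroup vs)) ⟩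
      I * N + X * N   ≡⟨ sym (*-distribʳ-+ N I X) ⟩
      (I + X) * N     ≡⟨ cong (_* N) (sym A≡) ⟩
      A * N           ≡⟨ cong (A *_) (sym (size-complement (span? vs))) ⟩
      A * (U + D)     ≡⟨ *-distribˡ-+ A U D ⟩
      A * U + A * D   ∎)

  -- Vectors are chosen from the last to the first. Every independent tail of length j has the same
  -- number qⁿ - qʲ of extensions, and `constrained-outside` bounds the admissible share of them, so
  -- the factors multiply as if the vectors were independent.
  constrained-families : ∀ {n j} (C : Fin j → Constraint n) →
    (∑ λ B → ind (satisfies? C B)) * q ^ ∑ (λ p → codim (C p)) ≤ #independent n j
  constrained-families {n} {zero} C = ≤-trans (≤-reflexive (trans
      (cong (λ z → (∑ λ B → ind (satisfies? C B)) * q ^ z) (∑≡sumOver (λ p → codim (C p)))) (*-identityʳ _)))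
    (∑-mono λ B → ind-mono (satisfies? C B) (independent? B) proj₁)
  constrained-families {n} {suc j} C = begin
    (∑ λ B → ind (satisfies? C B)) * q ^ ∑ (λ p → codim (C p))
      ≡⟨ cong₂ _*_ (trans (∑-Vec _) (∑-swap _))
           (trans (cong (q ^_) (∑-Fin (λ p → codim (C p)))) (^-distribˡ-+-* q (codim (C zero)) rest)) ⟩
    (∑ λ vs → ∑ λ v → ind (satisfies? C (v ∷ vs))) * (q ^ codim (C zero) * q ^ rest)
      ≡⟨ sym (*-assoc (∑ λ vs → ∑ λ v → ind (satisfies? C (v ∷ vs))) (q ^ codim (C zero)) (q ^ rest)) ⟩
    (∑ λ vs → ∑ λ v → ind (satisfies? C (v ∷ vs))) * q ^ codim (C zero) * q ^ rest
      ≡⟨ cong (_* q ^ rest) (sym (∑-*ʳ _ (q ^ codim (C zero)))) ⟩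
    (∑ λ vs → (∑ λ v → ind (satisfies? C (v ∷ vs))) * q ^ codim (C zero)) * q ^ rest
      ≤⟨ *-monoˡ-≤ (q ^ rest) (∑-mono new-vector) ⟩
    (∑ λ vs → ind (satisfies? (C ∘ suc) vs) * d) * q ^ rest
      ≡⟨ cong (_* q ^ rest) (∑-*ʳ _ d) ⟩
    (∑ λ vs → ind (satisfies? (C ∘ suc) vs)) * d * q ^ rest
      ≡⟨ swapʳ (∑ λ vs → ind (satisfies? (C ∘ suc) vs)) d (q ^ rest) ⟩
    (∑ λ vs → ind (satisfies? (C ∘ suc) vs)) * q ^ rest * d
      ≤⟨ *-monoˡ-≤ d (constrained-families (C ∘ suc)) ⟩
    #independent n j * d
      ≡⟨ sym (∑-*ʳ _ d) ⟩
    (∑ λ (vs : Vec (Vector n) j) → ind (independent? vs) * d)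
      ≤⟨ ∑-mono extensions ⟩
    (∑ λ (vs : Vec (Vector n) j) → ∑ λ v → ind (independent? (v ∷ vs)))
      ≡⟨ trans (∑-swap _) (sym (∑-Vec _)) ⟩
    #independent n (suc j) ∎
    where
    open ≤-Reasoning
    d = q ^ n ∸ q ^ j
    rest = ∑ λ p → codim (C (suc p))
    swapʳ : ∀ a b c → a * b * c ≡ a * c * b
    swapʳ = solve-∀
    new-vector : ∀ vs → (∑ λ v → ind (satisfies? C (v ∷ vs))) * q ^ codim (C zero) ≤ ind (satisfies? (C ∘ suc) vs) * d
    new-vector vs with satisfies? (C ∘ suc) vs
    ... | yes (li , h) = ≤-trans (≤-trans
            (*-monoˡ-≤ (q ^ codim (C zero)) (∑-mono λ v → ind-mono (satisfies? C (v ∷ vs)) (holds? (C zero) v ×-dec ¬? (span? vs v))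
              λ (li′ , h′) → h′ zero , independent-∉ li′))
            (constrained-outside (C zero) li)) (≤-reflexive (sym (*-identityˡ d)))
    ... | no ¬h = ≤-reflexive (cong (_* q ^ codim (C zero)) (trans
            (∑-cong λ v → ind-no (satisfies? C (v ∷ vs)) λ (li , h) → ¬h (independent-tail li , λ p → h (suc p))) ∑-0))
    extensions : ∀ vs → ind (independent? vs) * d ≤ ∑ λ v → ind (independent? (v ∷ vs))
    extensions vs with independent? vs
    ... | yes li = ≤-trans (≤-reflexive (trans (*-identityˡ d) (sym (outside-count li))))
            (∑-mono λ v → ind-mono (¬? (span? vs v)) (independent? (v ∷ vs)) (independent-∷ li))
    ... | no _ = z≤n

  -- Positions outside the image of `S` carry the trivial constraint. Injectivity of `S` ensures
  -- that no position has to meet two constraints, so that the codimensions add up.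
  constrained-bases : ∀ {n j b} (S : Fin b → Fin j) → (∀ x y → S x ≡ S y → x ≡ y) → (C : Fin b → Constraint n) →
    (∑ λ (B : Vec (Vector n) j) → ind (independent? B ×-dec ∀? λ x → holds? (C x) (lookup B (S x)))) * q ^ ∑ (λ x → codim (C x))
      ≤ #independent n j
  constrained-bases {n} {j} {b} S inj C = ≤-trans
    (*-mono-≤ (∑-mono λ B → ind-mono (independent? B ×-dec ∀? λ x → holds? (C x) (lookup B (S x))) (satisfies? C′ B)
                λ (li , h) → li , λ p → holds-at B h p (preimage? p))
              (^-monoʳ-≤ q codims))
    (constrained-families C′)
    where
    preimage? : ∀ p → Dec (∃ λ x → S x ≡ p)
    preimage? p = ∃? λ x → S x ≟ p
    at : ∀ {p} → Dec (∃ λ x → S x ≡ p) → Constraint n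
    at (yes (x , _)) = C x
    at (no _)        = unconstrained
    C′ : Fin j → Constraint n
    C′ p = at (preimage? p)
    holds-at : ∀ B → (∀ x → Holds (C x) (lookup B (S x))) → ∀ p (d : Dec (∃ λ x → S x ≡ p)) → Holds (at d) (lookup B p)
    holds-at B h p (yes (x , refl)) = h x
    holds-at B h p (no _)           = tt
    codim-at : ∀ p (d : Dec (∃ λ x → S x ≡ p)) → (∑ λ x → ind (p ≟ S x) * codim (C x)) ≤ codim (at d)
    codim-at p (yes (x , refl)) = ≤-reflexive (trans
      (∑-cong λ y → cong (_* codim (C y)) (ind-≡ (S x ≟ S y) (y ≟ x) (λ e → sym (inj x y e)) (λ { refl → refl })))
      (∑-pick x (λ y → codim (C y))))
    codim-at p (no none) = ≤-reflexive (trans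
      (∑-cong λ y → cong (_* codim (C y)) (ind-no (p ≟ S y) λ e → none (y , sym e))) ∑-0)
    codims : ∑ (λ x → codim (C x)) ≤ ∑ (λ p → codim (C′ p))
    codims = begin
      ∑ (λ x → codim (C x))                              ≡⟨ ∑-cong (λ x → sym (∑-pick (S x) (λ _ → codim (C x)))) ⟩
      (∑ λ x → ∑ λ p → ind (p ≟ S x) * codim (C x))      ≡⟨ ∑-swap _ ⟩
      (∑ λ p → ∑ λ x → ind (p ≟ S x) * codim (C x))      ≤⟨ ∑-mono (λ p → codim-at p (preimage? p)) ⟩
      ∑ (λ p → codim (C′ p))                             ∎
      where open ≤-Reasoning

  -- A single exchange step

  open Subgroup

  dots-zero⁺ : ∀ {n a} (fs : Fin a → Vector n) x → (∀ i → dot (fs i) x ≡ 0#) → dots (tabulate fs) x ≡ 0v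
  dots-zero⁺ {a = zero}  fs x h = refl
  dots-zero⁺ {a = suc a} fs x h = cong₂ _∷_ (h zero) (dots-zero⁺ (fs ∘ suc) x (h ∘ suc))

  dots-zero⁻ : ∀ {n a} (fs : Fin a → Vector n) x → dots (tabulate fs) x ≡ 0v → ∀ i → dot (fs i) x ≡ 0#
  dots-zero⁻ fs x e zero    = Vec.∷-injectiveˡ e
  dots-zero⁻ fs x e (suc i) = dots-zero⁻ (fs ∘ suc) x (Vec.∷-injectiveʳ e) i

  orthogonal? : ∀ {n a} (fs : Fin a → Vector n) x → Dec (∀ i → dot (fs i) x ≡ 0#)
  orthogonal? fs x = ∀? λ i → dot (fs i) x ≟ 0#

  orthogonal-subgroup : ∀ {n a} (fs : Fin a → Vector n) → Subgroup (λ x → ∀ i → dot (fs i) x ≡ 0#)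
  orthogonal-subgroup fs = record
    { zero∈ = λ i → dot-0ʳ (fs i)
    ; minus∈ = λ {x} {y} hx hy i → dot-minusʳ-0 (fs i) x y (trans (hx i) (sym (hy i))) }

  annihilator : ∀ {n a} (fs : Fin a → Vector n) → LinearlyIndependent (tabulate fs) → Constraint n
  annihilator {a = a} fs li = record
    { Holds = λ x → ∀ i → dot (fs i) x ≡ 0#
    ; holds? = orthogonal? fs
    ; subgroup = orthogonal-subgroup fs
    ; codim = a
    ; bound = ≤-reflexive (trans (cong (_* q ^ a) (∑-cong λ x →
        ind-≡ (orthogonal? fs x) (dots (tabulate fs) x ≟ 0v) (dots-zero⁺ fs x) (dots-zero⁻ fs x)))
        (annihilator-size (tabulate fs) li)) }

  independent-singleton : ∀ {n} {v : Vector n} → v ≢ 0v → LinearlyIndependent (v ∷ [])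
  independent-singleton {v = v} v≢0 (c ∷ []) e with c ≟ 0#
  ... | yes refl = refl
  ... | no c≢0 = contradiction (trans (sym (G.identityʳ (c ·v v))) e) (·v-nonzero c≢0 v≢0)

  Row : ℕ → Set
  Row n = Vec (Vector n) n

  #bases : ℕ → ℕ
  #bases n = #independent n n

  module _ {n : ℕ} (f : Fin n → Vector n) where

    AllZero : ∀ {a b} → (Fin a → Fin n) → (Fin b → Fin n) → Row n → Set
    AllZero C S B = ∀ y x → dot (f (C x)) (lookup B (S y)) ≡ 0#

    allZero? : ∀ {a b} (C : Fin a → Fin n) (S : Fin b → Fin n) B → Dec (AllZero C S B)
    allZero? C S B = ∀? λ y → ∀? λ x → dot (f (C x)) (lookup B (S y)) ≟ 0#

    some-nonzero : ∀ {a b} (C : Fin a → Fin n) (S : Fin b → Fin n) B → ¬ AllZero C S B →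
                   ∃₂ λ x y → dot (f (C x)) (lookup B (S y)) ≢ 0#
    some-nonzero C S B ¬z with ∃? (λ x → ∃? λ y → ¬? (dot (f (C x)) (lookup B (S y)) ≟ 0#))
    ... | yes (x , y , h) = x , y , h
    ... | no none = contradiction (λ y x → decidable-stable (dot (f (C x)) (lookup B (S y)) ≟ 0#) λ h → none (x , y , h)) ¬z

    -- Each of the `b` selected vectors must lie in the common kernel of `a` independent
    -- functionals, which costs codimension `a` every time. The separate `e` lets the products 1 * s
    -- and s * 1 arrive simplified.
    allZero-count : ∀ {a b} (C : Fin a → Fin n) (S : Fin b → Fin n) →
                    LinearlyIndependent (tabulate (f ∘ C)) → Injective S → ∀ {e} → b * a ≡ e →
                    (∑ λ B → ind (independent? B ×-dec allZero? C S B)) * q ^ e ≤ #bases n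
    allZero-count {a} {b} C S li inj refl = subst (λ z → (∑ λ B → ind (independent? B ×-dec allZero? C S B)) * q ^ z ≤ #bases n)
      (trans (∑-const {Fin b} a) (cong (_* a) (card-Fin b)))
      (constrained-bases S inj (λ _ → annihilator (f ∘ C) li))

  module Blocks {n s : ℕ} (s²≤n : s * s ≤ n) where

    -- Disjoint blocks convert hits into degrees: one hit in each of the `s` blocks yields `s`
    -- different neighbours, while a fixed block is missed entirely with probability at most q⁻ˢ.
    block : Fin s → Fin s → Fin n
    block j x = inject≤ (combine j x) s²≤n

    block-injectiveˡ : ∀ {j x j′ x′} → block j x ≡ block j′ x′ → j ≡ j′
    block-injectiveˡ e = Fin.combine-injectiveˡ _ _ _ _ (Fin.inject≤-injective s²≤n s²≤n _ _ e)

    block-injective : ∀ j → Injective (block j)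
    block-injective j x y e = Fin.combine-injectiveʳ j x j y (Fin.inject≤-injective s²≤n s²≤n _ _ e)

    module _ (f : Fin n → Vector n) where

      -- One event for each hypothesis of `Exchange`; if none occurs, the graph of nonzero values
      -- has a perfect matching. The two families in `BadPair` are vectors rather than functions,
      -- which makes them enumerable with n ^ s choices each.
      BadColumns BadPositions BadPair BadStep : Row n → Set
      BadColumns B   = ∃ λ p → ∃ λ j → AllZero f (block j) (λ (_ : Fin 1) → p) B
      BadPositions B = ∃ λ k → ∃ λ j → AllZero f (λ (_ : Fin 1) → k) (block j) B
      BadPair B      = ∃ λ (C : Vec (Fin n) s) → ∃ λ (S : Vec (Fin n) s) →
                       Injective (lookup C) × Injective (lookup S) × AllZero f (lookup C) (lookup S) B
      BadStep B      = BadColumns B ⊎ BadPositions B ⊎ BadPair B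

      badColumns? : ∀ B → Dec (BadColumns B)
      badColumns? B = ∃? λ p → ∃? λ j → allZero? f (block j) (λ _ → p) B

      badPositions? : ∀ B → Dec (BadPositions B)
      badPositions? B = ∃? λ k → ∃? λ j → allZero? f (λ _ → k) (block j) B

      badPair? : ∀ B → Dec (BadPair B)
      badPair? B = ∃? λ C → ∃? λ S → injective? (lookup C) ×-dec injective? (lookup S) ×-dec allZero? f (lookup C) (lookup S) B

      badStep? : ∀ B → Dec (BadStep B)
      badStep? B = badColumns? B ⊎-dec badPositions? B ⊎-dec badPair? B

      good-permutation : ∀ B → ¬ BadStep B → ∃ λ (π : Permutation′ n) → ∀ k → dot (f k) (lookup B (π ⟨$⟩ʳ k)) ≢ 0#
      good-permutation B ¬bad = Exchange.perfect-matching {t = s} (λ k p → dot (f k) (lookup B p) ≢ 0#)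
          (λ k p → ¬? (dot (f k) (lookup B p) ≟ 0#)) columns positions dense
        where
        columns : ∀ p → ∃ λ (I : Fin s → Fin n) → Injective I × (∀ x → dot (f (I x)) (lookup B p) ≢ 0#)
        columns p = (λ j → block j (proj₁ (hit j))) , (λ _ _ → block-injectiveˡ) , λ j → proj₂ (proj₂ (hit j))
          where
          hit : ∀ j → ∃₂ λ x (y : Fin 1) → dot (f (block j x)) (lookup B p) ≢ 0#
          hit j = some-nonzero f (block j) (λ _ → p) B λ z → ¬bad (inj₁ (p , j , z))
        positions : ∀ k → ∃ λ (S : Fin s → Fin n) → Injective S × (∀ x → dot (f k) (lookup B (S x)) ≢ 0#)
        positions k = (λ j → block j (proj₁ (proj₂ (hit j)))) , (λ _ _ → block-injectiveˡ) , λ j → proj₂ (proj₂ (hit j))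
          where
          hit : ∀ j → ∃₂ λ (x : Fin 1) y → dot (f k) (lookup B (block j y)) ≢ 0#
          hit j = some-nonzero f (λ _ → k) (block j) B λ z → ¬bad (inj₂ (inj₁ (k , j , z)))
        dense : ∀ (C S : Fin s → Fin n) → Injective C → Injective S → ∃₂ λ x y → dot (f (C x)) (lookup B (S y)) ≢ 0#
        dense C S injC injS = some-nonzero f C S B λ z → ¬bad (inj₂ (inj₂ (tabulate C , tabulate S ,
            transport C injC , transport S injS ,
            λ y x → subst₂ (λ c p → dot (f c) (lookup B p) ≡ 0#) (sym (Vec.lookup∘tabulate C x)) (sym (Vec.lookup∘tabulate S y)) (z y x))))
          where
          transport : (C : Fin s → Fin n) → Injective C → Injective (lookup (tabulate C))
          transport C inj x y e = inj x y (trans (sym (Vec.lookup∘tabulate C x)) (trans e (Vec.lookup∘tabulate C y)))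

      module _ (f≢0 : ∀ k → f k ≢ 0v)
               (f-independent : ∀ (C : Fin s → Fin n) → Injective C → LinearlyIndependent (tabulate (f ∘ C)))
               (s-large : n ^ s * n ^ s * q ^ s ≤ q ^ (s * s)) where

        badColumns-count : (∑ λ B → ind (independent? B ×-dec badColumns? B)) * q ^ s ≤ n * (s * #bases n)
        badColumns-count = ≤-trans (union-count _ (λ p B → independent? B ×-dec ∃? λ j → allZero? f (block j) (λ (_ : Fin 1) → p) B) (q ^ s) (s * #bases n)
            (λ B (li , p , h) → p , li , h)
            (λ p → ≤-trans (union-count _ (λ j B → independent? B ×-dec allZero? f (block j) (λ (_ : Fin 1) → p) B) (q ^ s) (#bases n)
              (λ B (li , j , h) → j , li , h)
              (λ j → allZero-count f (block j) (λ _ → p) (f-independent (block j) (block-injective j)) (λ { zero zero _ → refl }) (*-identityˡ s)))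
              (≤-reflexive (cong (_* #bases n) (card-Fin s)))))
          (≤-reflexive (cong (_* (s * #bases n)) (card-Fin n)))

        badPositions-count : (∑ λ B → ind (independent? B ×-dec badPositions? B)) * q ^ s ≤ n * (s * #bases n)
        badPositions-count = ≤-trans (union-count _ (λ k B → independent? B ×-dec ∃? λ j → allZero? f (λ (_ : Fin 1) → k) (block j) B) (q ^ s) (s * #bases n)
            (λ B (li , k , h) → k , li , h)
            (λ k → ≤-trans (union-count _ (λ j B → independent? B ×-dec allZero? f (λ (_ : Fin 1) → k) (block j) B) (q ^ s) (#bases n)
              (λ B (li , j , h) → j , li , h)
              (λ j → allZero-count f (λ _ → k) (block j) (independent-singleton (f≢0 k)) (block-injective j) (*-identityʳ s)))
              (≤-reflexive (cong (_* #bases n) (card-Fin s)))))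
          (≤-reflexive (cong (_* (s * #bases n)) (card-Fin n)))

        -- A fixed pair is bad with probability at most q to the -s², and `s-large` is the condition
        -- under which the n ^ s * n ^ s pairs together still cost at most q⁻ˢ.
        badPair-count : (∑ λ B → ind (independent? B ×-dec badPair? B)) * q ^ s ≤ #bases n
        badPair-count = *-cancelʳ-≤ _ _ (q ^ (s * s)) {{m^n≢0 q (s * s)}} (begin
          X * q ^ s * q ^ (s * s)         ≡⟨ r₁ X (q ^ s) (q ^ (s * s)) ⟩
          X * q ^ (s * s) * q ^ s         ≤⟨ *-monoˡ-≤ (q ^ s) count ⟩
          n ^ s * (n ^ s * M) * q ^ s     ≡⟨ r₂ (n ^ s) M (q ^ s) ⟩
          M * (n ^ s * n ^ s * q ^ s)     ≤⟨ *-monoʳ-≤ M s-large ⟩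
          M * q ^ (s * s)                 ∎)
          where
          open ≤-Reasoning
          X = ∑ λ B → ind (independent? B ×-dec badPair? B)
          M = #bases n
          r₁ : ∀ a b c → a * b * c ≡ a * c * b
          r₁ = solve-∀
          r₂ : ∀ a b c → a * (a * b) * c ≡ b * (a * a * c)
          r₂ = solve-∀
          card-indices : card (Vec (Fin n) s) ≡ n ^ s
          card-indices = trans (card-Vec s) (cong (_^ s) (card-Fin n))
          pair? : ∀ (C S : Vec (Fin n) s) B → Dec (Injective (lookup C) × Injective (lookup S) × AllZero f (lookup C) (lookup S) B)
          pair? C S B = injective? (lookup C) ×-dec injective? (lookup S) ×-dec allZero? f (lookup C) (lookup S) B
          one : ∀ C S → (∑ λ B → ind (independent? B ×-dec pair? C S B)) * q ^ (s * s) ≤ M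
          one C S = by-cases (injective? (lookup C)) (injective? (lookup S))
            where
            none : ¬ (Injective (lookup C) × Injective (lookup S)) → (∑ λ B → ind (independent? B ×-dec pair? C S B)) * q ^ (s * s) ≤ M
            none h = ≤-trans (≤-reflexive (cong (_* q ^ (s * s)) (trans
              (∑-cong λ B → ind-no (independent? B ×-dec pair? C S B) λ (_ , iC , iS , _) → h (iC , iS)) ∑-0))) z≤n
            by-cases : Dec (Injective (lookup C)) → Dec (Injective (lookup S)) → (∑ λ B → ind (independent? B ×-dec pair? C S B)) * q ^ (s * s) ≤ M
            by-cases (yes iC) (yes iS) = ≤-trans (*-monoˡ-≤ (q ^ (s * s)) (∑-mono λ B →
                ind-mono (independent? B ×-dec pair? C S B) (independent? B ×-dec allZero? f (lookup C) (lookup S) B) λ (li , _ , _ , z) → li , z))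
              (allZero-count f (lookup C) (lookup S) (f-independent (lookup C) iC) iS refl)
            by-cases (no ¬iC) _ = none (λ (iC , _) → ¬iC iC)
            by-cases _ (no ¬iS) = none (λ (_ , iS) → ¬iS iS)
          count : X * q ^ (s * s) ≤ n ^ s * (n ^ s * M)
          count = ≤-trans (union-count _ (λ C B → independent? B ×-dec ∃? λ S → pair? C S B) (q ^ (s * s)) (n ^ s * M)
              (λ B (li , C , h) → C , li , h)
              (λ C → ≤-trans (union-count _ (λ S B → independent? B ×-dec pair? C S B) (q ^ (s * s)) M
                (λ B (li , S , h) → S , li , h) (one C))
                (≤-reflexive (cong (_* M) card-indices))))
            (≤-reflexive (cong (_* (n ^ s * M)) card-indices))

        badStep-count : (∑ λ B → ind (independent? B ×-dec badStep? B)) * q ^ s ≤ (2 * (n * s) + 1) * #bases n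
        badStep-count = begin
          (∑ λ B → ind (independent? B ×-dec badStep? B)) * q ^ s ≤⟨ *-monoˡ-≤ (q ^ s) (∑-mono split) ⟩
          (∑ λ B → X₁ B + (X₂ B + X₃ B)) * q ^ s ≡⟨ cong (_* q ^ s) (trans (∑-+ X₁ _) (cong (∑ X₁ +_) (∑-+ X₂ X₃))) ⟩
          (∑ X₁ + (∑ X₂ + ∑ X₃)) * q ^ s ≡⟨ r₁ (∑ X₁) (∑ X₂) (∑ X₃) (q ^ s) ⟩
          ∑ X₁ * q ^ s + (∑ X₂ * q ^ s + ∑ X₃ * q ^ s) ≤⟨ +-mono-≤ badColumns-count (+-mono-≤ badPositions-count badPair-count) ⟩
          n * (s * M) + (n * (s * M) + M) ≡⟨ r₂ n s M ⟩
          (2 * (n * s) + 1) * M ∎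
          where
          open ≤-Reasoning
          M = #bases n
          X₁ X₂ X₃ : Row n → ℕ
          X₁ B = ind (independent? B ×-dec badColumns? B)
          X₂ B = ind (independent? B ×-dec badPositions? B)
          X₃ B = ind (independent? B ×-dec badPair? B)
          r₁ : ∀ a b c d → (a + (b + c)) * d ≡ a * d + (b * d + c * d)
          r₁ = solve-∀
          r₂ : ∀ n s M → n * (s * M) + (n * (s * M) + M) ≡ (2 * (n * s) + 1) * M
          r₂ = solve-∀
          split : ∀ B → ind (independent? B ×-dec badStep? B) ≤ X₁ B + (X₂ B + X₃ B)
          split B = ≤-trans
            (ind-⊎ (independent? B ×-dec badStep? B) (independent? B ×-dec badColumns? B) (independent? B ×-dec (badPositions? B ⊎-dec badPair? B))
              λ { (li , inj₁ h) → inj₁ (li , h) ; (li , inj₂ h) → inj₂ (li , h) })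
            (+-monoʳ-≤ (X₁ B) (ind-⊎ (independent? B ×-dec (badPositions? B ⊎-dec badPair? B)) (independent? B ×-dec badPositions? B) (independent? B ×-dec badPair? B)
              λ { (li , inj₁ h) → inj₁ (li , h) ; (li , inj₂ h) → inj₂ (li , h) }))

  -- The rows that are left unpermuted

  AllBases : ∀ {n m} → Vec (Row n) m → Set
  AllBases Bs = ∀ i → LinearlyIndependent (lookup Bs i)

  allBases? : ∀ {n m} (Bs : Vec (Row n) m) → Dec (AllBases Bs)
  allBases? Bs = ∀? λ i → independent? (lookup Bs i)

  families-count : ∀ n m → (∑ λ (Bs : Vec (Row n) m) → ind (allBases? Bs)) ≡ #bases n ^ m
  families-count n m = count-all independent? m

  column : ∀ {n m} → Fin n → Vec (Row n) m → Vec (Vector n) m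
  column k = map (λ B → lookup B k)

  dependent? : ∀ {n m} (k : Fin n) (Bs : Vec (Row n) m) → Dec (AllBases Bs × ¬ LinearlyIndependent (column k Bs))
  dependent? k Bs = allBases? Bs ×-dec ¬? (independent? (column k Bs))

  in-span-count : ∀ {n m} → m ≤ n → (k : Fin n) (vs : Vec (Vector n) m) →
                  (∑ λ (B : Row n) → ind (independent? B ×-dec span? vs (lookup B k))) * q ^ n ≤ q ^ m * #bases n
  in-span-count {n} {m} m≤n k vs = begin
    X * q ^ n                  ≡⟨ cong (λ z → X * q ^ z) (sym (m∸n+n≡m m≤n)) ⟩
    X * q ^ (n ∸ m + m)        ≡⟨ cong (X *_) (^-distribˡ-+-* q (n ∸ m) m) ⟩
    X * (q ^ (n ∸ m) * q ^ m)  ≡⟨ r X (q ^ (n ∸ m)) (q ^ m) ⟩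
    q ^ m * (X * q ^ (n ∸ m))  ≤⟨ *-monoʳ-≤ (q ^ m) (begin
      X * q ^ (n ∸ m)   ≤⟨ *-mono-≤ (∑-mono λ B → ind-mono (independent? B ×-dec span? vs (lookup B k))
                              (independent? B ×-dec ∀? λ (x : Fin 1) → span? vs (lookup B k)) λ (li , h) → li , λ _ → h)
                            (≤-reflexive (cong (q ^_) (sym (trans (∑-const {Fin 1} (n ∸ m)) (cong (_* (n ∸ m)) (card-Fin 1)) ⟨ trans ⟩ *-identityˡ (n ∸ m))))) ⟩
      (∑ λ (B : Row n) → ind (independent? B ×-dec ∀? λ (x : Fin 1) → span? vs (lookup B k))) * q ^ ∑ {Fin 1} (λ _ → n ∸ m)
                        ≤⟨ constrained-bases (λ (_ : Fin 1) → k) (λ { zero zero _ → refl }) (λ _ → in-span) ⟩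
      #bases n          ∎) ⟩
    q ^ m * #bases n           ∎
    where
    open ≤-Reasoning
    X = ∑ λ (B : Row n) → ind (independent? B ×-dec span? vs (lookup B k))
    r : ∀ a b c → a * (b * c) ≡ c * (a * b)
    r = solve-∀
    in-span : Constraint n
    in-span = record
      { Holds = Span vs ; holds? = span? vs ; subgroup = span-subgroup vs ; codim = n ∸ m
      ; bound = ≤-trans (*-monoˡ-≤ (q ^ (n ∸ m)) (span-size≤ vs))
          (≤-reflexive (trans (sym (^-distribˡ-+-* q m (n ∸ m))) (cong (q ^_) (m+[n∸m]≡n m≤n)))) }

  -- The term M ^ m absorbs the geometric series Σ qⁱ.
  dependent-count : ∀ {n} m → m ≤ n → (k : Fin n) →
    (∑ λ (Bs : Vec (Row n) m) → ind (dependent? k Bs)) * q ^ n + #bases n ^ m ≤ q ^ m * #bases n ^ m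
  dependent-count {n} zero    _     k = ≤-reflexive (cong (λ z → z * q ^ n + 1) (trans
    (∑-cong λ { [] → ind-no (dependent? k []) λ (_ , h) → h λ { [] _ → refl } }) ∑-0))
  dependent-count {n} (suc m) m<n k = begin
    (∑ λ Bs → ind (dependent? k Bs)) * q ^ n + M * M ^ m
      ≡⟨ cong (λ z → z * q ^ n + M * M ^ m) (trans (∑-Vec _) (∑-swap _)) ⟩
    (∑ λ Bs → ∑ λ B → ind (dependent? k (B ∷ Bs))) * q ^ n + M * M ^ m
      ≤⟨ +-monoˡ-≤ (M * M ^ m) (*-monoˡ-≤ (q ^ n) (∑-mono λ Bs → ∑-mono λ B → split B Bs)) ⟩
    (∑ λ Bs → ∑ λ B → ind (independent? B) * ind (dependent? k Bs) + ind (allBases? Bs) * Y Bs B) * q ^ n + M * M ^ m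
      ≡⟨ cong (λ z → z * q ^ n + M * M ^ m) (trans (∑-cong λ Bs → trans (∑-+ _ _) (cong₂ _+_ (∑-*ʳ _ (ind (dependent? k Bs))) (∑-*ˡ (ind (allBases? Bs)) (Y Bs)))) (∑-+ _ _)) ⟩
    ((∑ λ Bs → M * ind (dependent? k Bs)) + (∑ λ Bs → ind (allBases? Bs) * ∑ (Y Bs))) * q ^ n + M * M ^ m
      ≡⟨ cong (λ z → (z + Z) * q ^ n + M * M ^ m) (∑-*ˡ M _) ⟩
    (M * D + Z) * q ^ n + M * M ^ m
      ≡⟨ r₁ M D Z (q ^ n) (M ^ m) ⟩
    M * (D * q ^ n + M ^ m) + Z * q ^ n
      ≤⟨ +-mono-≤ (*-monoʳ-≤ M (dependent-count m (<⇒≤ m<n) k)) Z-bound ⟩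
    M * (q ^ m * M ^ m) + M ^ m * (q ^ m * M)
      ≡⟨ r₂ M (q ^ m) (M ^ m) ⟩
    -- Old dependencies and a new vector falling into the span contribute qᵐ each; the sum 2 qᵐ is
    -- at most q to the m + 1.
    2 * (q ^ m * (M * M ^ m))
      ≤⟨ *-monoˡ-≤ _ q≥2 ⟩
    q * (q ^ m * (M * M ^ m))
      ≡⟨ sym (*-assoc q (q ^ m) _) ⟩
    q * q ^ m * (M * M ^ m) ∎
    where
    open ≤-Reasoning
    M = #bases n
    D = ∑ λ (Bs : Vec (Row n) m) → ind (dependent? k Bs)
    Y : Vec (Row n) m → Row n → ℕ
    Y Bs B = ind (independent? B ×-dec span? (column k Bs) (lookup B k))
    Z = ∑ λ Bs → ind (allBases? Bs) * ∑ (Y Bs)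
    Z-bound : Z * q ^ n ≤ M ^ m * (q ^ m * M)
    Z-bound = begin
      Z * q ^ n                                              ≡⟨ sym (∑-*ʳ _ (q ^ n)) ⟩
      (∑ λ Bs → ind (allBases? Bs) * ∑ (Y Bs) * q ^ n)       ≤⟨ ∑-mono (λ Bs → ≤-trans (≤-reflexive (*-assoc (ind (allBases? Bs)) _ (q ^ n)))
                                                                  (*-monoʳ-≤ (ind (allBases? Bs)) (in-span-count (<⇒≤ m<n) k (column k Bs)))) ⟩
      (∑ λ Bs → ind (allBases? Bs) * (q ^ m * M))            ≡⟨ ∑-*ʳ _ (q ^ m * M) ⟩
      (∑ λ (Bs : Vec (Row n) m) → ind (allBases? Bs)) * (q ^ m * M)  ≡⟨ cong (_* (q ^ m * M)) (families-count n m) ⟩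
      M ^ m * (q ^ m * M)                                    ∎
    r₁ : ∀ M D Z Q P → (M * D + Z) * Q + M * P ≡ M * (D * Q + P) + Z * Q
    r₁ = solve-∀
    r₂ : ∀ M Q P → M * (Q * P) + P * (Q * M) ≡ 2 * (Q * (M * P))
    r₂ = solve-∀
    split : ∀ B Bs → ind (dependent? k (B ∷ Bs)) ≤ ind (independent? B) * ind (dependent? k Bs) + ind (allBases? Bs) * Y Bs B
    split B Bs = ≤-trans
      (ind-⊎ (dependent? k (B ∷ Bs)) (independent? B ×-dec dependent? k Bs) (allBases? Bs ×-dec (independent? B ×-dec span? (column k Bs) (lookup B k))) cases)
      (≤-reflexive (cong₂ _+_ (ind-× (independent? B) (dependent? k Bs)) (ind-× (allBases? Bs) (independent? B ×-dec span? (column k Bs) (lookup B k)))))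
      where
      cases : AllBases (B ∷ Bs) × ¬ LinearlyIndependent (column k (B ∷ Bs)) →
              (LinearlyIndependent B × AllBases Bs × ¬ LinearlyIndependent (column k Bs)) ⊎
              (AllBases Bs × LinearlyIndependent B × Span (column k Bs) (lookup B k))
      cases (all , dep) = by (independent? (column k Bs)) (span? (column k Bs) (lookup B k))
        where
        by : Dec (LinearlyIndependent (column k Bs)) → Dec (Span (column k Bs) (lookup B k)) → _
        by (no ¬li) _        = inj₁ (all zero , all ∘ suc , ¬li)
        by (yes li) (yes sp) = inj₂ (all ∘ suc , all zero , sp)
        by (yes li) (no ¬sp) = contradiction (independent-∷ li ¬sp) dep

  some-dependent? : ∀ {n m} (Bs : Vec (Row n) m) → Dec (AllBases Bs × ∃ λ k → ¬ LinearlyIndependent (column k Bs))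
  some-dependent? Bs = allBases? Bs ×-dec ∃? λ k → ¬? (independent? (column k Bs))

  some-dependent-count : ∀ {n} L m → L + m ≡ n →
    (∑ λ (Bs : Vec (Row n) m) → ind (some-dependent? Bs)) * q ^ L ≤ n * #bases n ^ m
  some-dependent-count {n} L m refl = *-cancelʳ-≤ _ _ (q ^ m) {{m^n≢0 q m}} (begin
    X * q ^ L * q ^ m             ≡⟨ trans (*-assoc X (q ^ L) (q ^ m)) (cong (X *_) (sym (^-distribˡ-+-* q L m))) ⟩
    X * q ^ n                     ≤⟨ union-count some-dependent? dependent? (q ^ n) (q ^ m * #bases n ^ m)
                                       (λ Bs (all , k , dep) → k , all , dep)
                                       (λ k → m+n≤o⇒m≤o _ (dependent-count m (m≤n+m m L) k)) ⟩
    card (Fin n) * (q ^ m * #bases n ^ m)  ≡⟨ cong (_* (q ^ m * #bases n ^ m)) (card-Fin n) ⟩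
    n * (q ^ m * #bases n ^ m)    ≡⟨ r n (q ^ m) (#bases n ^ m) ⟩
    n * #bases n ^ m * q ^ m      ∎)
    where
    open ≤-Reasoning
    X = ∑ λ (Bs : Vec (Row n) m) → ind (some-dependent? Bs)
    r : ∀ a b c → a * (b * c) ≡ a * c * b
    r = solve-∀

  -- Weighted counts of tuples of functionals with prescribed sum

  vsum : ∀ {n s} → Vec (Vector n) s → Vector n
  vsum []       = 0v
  vsum (g ∷ gs) = g +v vsum gs

  zeros : ∀ {n s} → Vec (Vector n) s → ℕ
  zeros gs = ∑ λ j → ind (lookup gs j ≟ 0v)

  -- A zero functional imposes no condition on a row and hence saves no factor q in any of the m rows.
  weight : ∀ {n s} → ℕ → Vec (Vector n) s → ℕ
  weight m []       = 1
  weight m (g ∷ gs) = q ^ (m * ind (g ≟ 0v)) * weight m gs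

  weight≡ : ∀ {n s} m (gs : Vec (Vector n) s) → weight m gs ≡ q ^ (m * zeros gs)
  weight≡ m []       = sym (trans (cong (λ z → q ^ (m * z)) (∑≡sumOver {Fin 0} _)) (cong (q ^_) (*-zeroʳ m)))
  weight≡ m (g ∷ gs) = sym (begin
    q ^ (m * zeros (g ∷ gs))                           ≡⟨ cong (λ z → q ^ (m * z)) (∑-Fin (λ j → ind (lookup (g ∷ gs) j ≟ 0v))) ⟩
    q ^ (m * (ind (g ≟ 0v) + zeros gs))                ≡⟨ cong (q ^_) (*-distribˡ-+ m (ind (g ≟ 0v)) (zeros gs)) ⟩
    q ^ (m * ind (g ≟ 0v) + m * zeros gs)              ≡⟨ ^-distribˡ-+-* q (m * ind (g ≟ 0v)) _ ⟩
    q ^ (m * ind (g ≟ 0v)) * q ^ (m * zeros gs)        ≡⟨ cong (q ^ (m * ind (g ≟ 0v)) *_) (sym (weight≡ m gs)) ⟩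
    q ^ (m * ind (g ≟ 0v)) * weight m gs               ∎)
    where open ≡-Reasoning

  -- The zero vector has weight qᵐ ≤ qⁿ and every other vector weight 1; bounding 2 qⁿ by q * qⁿ
  -- costs one extra factor q, the origin of `suc n`.
  vector-weights : ∀ {n m} → m ≤ n → (∑ λ (g : Vector n) → q ^ (m * ind (g ≟ 0v))) ≤ q ^ suc n
  vector-weights {n} {m} m≤n = begin
    (∑ λ (g : Vector n) → q ^ (m * ind (g ≟ 0v)))         ≤⟨ ∑-mono (λ g → pointwise (g ≟ 0v)) ⟩
    (∑ λ (g : Vector n) → 1 + ind (g ≟ 0v) * q ^ m)       ≡⟨ ∑-+ _ _ ⟩
    card (Vector n) + (∑ λ g → ind (g ≟ 0v) * q ^ m)      ≡⟨ cong₂ _+_ (card-Vector n) (∑-pick 0v (λ _ → q ^ m)) ⟩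
    q ^ n + q ^ m                                         ≤⟨ +-monoʳ-≤ (q ^ n) (^-monoʳ-≤ q m≤n) ⟩
    q ^ n + q ^ n                                         ≡⟨ cong (q ^ n +_) (sym (+-identityʳ (q ^ n))) ⟩
    2 * q ^ n                                             ≤⟨ *-monoˡ-≤ (q ^ n) q≥2 ⟩
    q ^ suc n                                             ∎
    where
    open ≤-Reasoning
    pointwise : {P : Set} (d : Dec P) → q ^ (m * ind d) ≤ 1 + ind d * q ^ m
    pointwise (yes _) = ≤-trans (≤-reflexive (trans (cong (q ^_) (*-identityʳ m)) (sym (*-identityˡ (q ^ m))))) (n≤1+n _)
    pointwise (no _)  = ≤-reflexive (cong (q ^_) (*-zeroʳ m))

  total-weight : ∀ {n m} → m ≤ n → ∀ s → (∑ λ (gs : Vec (Vector n) s) → weight m gs) ≤ (q ^ suc n) ^ s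
  total-weight m≤n zero = ≤-reflexive (trans (∑-cong {g = λ _ → 1} λ { [] → refl }) (card-Vec 0))
  total-weight {n} {m} m≤n (suc s) = begin
    (∑ λ (gs : Vec (Vector n) (suc s)) → weight m gs)                            ≡⟨ ∑-Vec (weight m) ⟩
    (∑ λ (g : Vector n) → ∑ λ gs → q ^ (m * ind (g ≟ 0v)) * weight m gs)         ≡⟨ ∑-cong (λ g → ∑-*ˡ (q ^ (m * ind (g ≟ 0v))) (weight m)) ⟩
    (∑ λ (g : Vector n) → q ^ (m * ind (g ≟ 0v)) * ∑ (weight m))                 ≡⟨ ∑-*ʳ _ (∑ (weight m)) ⟩
    (∑ λ (g : Vector n) → q ^ (m * ind (g ≟ 0v))) * ∑ (weight m)                 ≤⟨ *-mono-≤ (vector-weights m≤n) (total-weight m≤n s) ⟩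
    (q ^ suc n) ^ suc s                                                          ∎
    where open ≤-Reasoning

  Relation : ∀ {n s} → Fin s → Vector n → Vec (Vector n) s → Set
  Relation j y gs = lookup gs j ≢ 0v × vsum gs ≡ y

  relation? : ∀ {n s} (j : Fin s) (y : Vector n) gs → Dec (Relation j y gs)
  relation? j y gs = ¬? (lookup gs j ≟ 0v) ×-dec (vsum gs ≟ y)

  -- The entry at position j is nonzero and determined by the others, so it contributes a factor at most 1.
  relation-weight : ∀ {n m} → m ≤ n → ∀ {s} (j : Fin (suc s)) (y : Vector n) →
                    (∑ λ gs → ind (relation? j y gs) * weight m gs) ≤ (q ^ suc n) ^ s
  relation-weight {n} {m} m≤n {s} zero y = begin
    (∑ λ gs → ind (relation? zero y gs) * weight m gs)                      ≡⟨ trans (∑-Vec _) (∑-swap _) ⟩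
    (∑ λ gs → ∑ λ g → ind (relation? zero y (g ∷ gs)) * weight m (g ∷ gs))  ≤⟨ ∑-mono (λ gs → begin
      (∑ λ g → ind (relation? zero y (g ∷ gs)) * weight m (g ∷ gs))           ≤⟨ ∑-mono (λ g → pointwise g gs) ⟩
      (∑ λ g → ind (g +v vsum gs ≟ y) * weight m gs)                          ≡⟨ ∑-*ʳ _ (weight m gs) ⟩
      (∑ λ g → ind (g +v vsum gs ≟ y)) * weight m gs                          ≤⟨ *-monoˡ-≤ (weight m gs) (∑-unique (λ g → g +v vsum gs ≟ y)
                                                                                   λ g h e e′ → +v-cancelʳ (vsum gs) g h (trans e (sym e′))) ⟩
      1 * weight m gs                                                         ≡⟨ *-identityˡ (weight m gs) ⟩
      weight m gs                                                             ∎) ⟩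
    ∑ (weight m)                                                            ≤⟨ total-weight m≤n s ⟩
    (q ^ suc n) ^ s                                                         ∎
    where
    open ≤-Reasoning
    pointwise : ∀ g gs → ind (relation? zero y (g ∷ gs)) * weight m (g ∷ gs) ≤ ind (g +v vsum gs ≟ y) * weight m gs
    pointwise g gs = begin
      ind (relation? zero y (g ∷ gs)) * (q ^ (m * ind (g ≟ 0v)) * weight m gs)  ≡⟨ sym (*-assoc (ind (relation? zero y (g ∷ gs))) _ (weight m gs)) ⟩
      ind (relation? zero y (g ∷ gs)) * q ^ (m * ind (g ≟ 0v)) * weight m gs    ≤⟨ *-monoˡ-≤ (weight m gs) (factor (g ≟ 0v) (g +v vsum gs ≟ y)) ⟩
      ind (g +v vsum gs ≟ y) * weight m gs                                      ∎
      where
      factor : {P Q : Set} (d : Dec P) (e : Dec Q) → ind (¬? d ×-dec e) * q ^ (m * ind d) ≤ ind e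
      factor (yes _) e = z≤n
      factor (no ¬p) e = ≤-reflexive (trans (cong₂ _*_ (trans (ind-× (yes ¬p) e) (*-identityˡ (ind e))) (cong (q ^_) (*-zeroʳ m))) (*-identityʳ (ind e)))
  relation-weight {n} {m} m≤n {suc s} (suc j) y = begin
    (∑ λ gs → ind (relation? (suc j) y gs) * weight m gs)                                  ≡⟨ ∑-Vec _ ⟩
    (∑ λ g → ∑ λ gs → ind (relation? (suc j) y (g ∷ gs)) * weight m (g ∷ gs))              ≤⟨ ∑-mono (λ g → begin
      (∑ λ gs → ind (relation? (suc j) y (g ∷ gs)) * weight m (g ∷ gs))                      ≤⟨ ∑-mono (λ gs → pointwise g gs) ⟩
      -- Moving `g` to the other side changes the prescribed sum, hence the arbitrary target `y`;
      -- the application has target 0.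
      (∑ λ gs → q ^ (m * ind (g ≟ 0v)) * (ind (relation? j (y -v g) gs) * weight m gs))      ≡⟨ ∑-*ˡ (q ^ (m * ind (g ≟ 0v))) _ ⟩
      q ^ (m * ind (g ≟ 0v)) * (∑ λ gs → ind (relation? j (y -v g) gs) * weight m gs)        ≤⟨ *-monoʳ-≤ (q ^ (m * ind (g ≟ 0v))) (relation-weight m≤n j (y -v g)) ⟩
      q ^ (m * ind (g ≟ 0v)) * (q ^ suc n) ^ s                                               ∎) ⟩
    (∑ λ g → q ^ (m * ind (g ≟ 0v)) * (q ^ suc n) ^ s)                                     ≡⟨ ∑-*ʳ _ ((q ^ suc n) ^ s) ⟩
    (∑ λ g → q ^ (m * ind (g ≟ 0v))) * (q ^ suc n) ^ s                                     ≤⟨ *-monoˡ-≤ ((q ^ suc n) ^ s) (vector-weights m≤n) ⟩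
    (q ^ suc n) ^ suc s                                                                    ∎
    where
    open ≤-Reasoning
    assoc-swap : ∀ a b c → a * (b * c) ≡ b * (a * c)
    assoc-swap = solve-∀
    solve-for : ∀ g v → g +v v ≡ y → v ≡ y -v g
    solve-for g v e = trans (sym (trans (G.assoc v g (-v g)) (trans (cong (v +v_) (G.inverseʳ g)) (G.identityʳ v))))
      (cong (_-v g) (trans (G.comm v g) e))
    pointwise : ∀ g gs → ind (relation? (suc j) y (g ∷ gs)) * weight m (g ∷ gs) ≤
                         q ^ (m * ind (g ≟ 0v)) * (ind (relation? j (y -v g) gs) * weight m gs)
    pointwise g gs = ≤-trans (*-monoˡ-≤ (weight m (g ∷ gs)) (ind-mono (relation? (suc j) y (g ∷ gs)) (relation? j (y -v g) gs)
        λ (≢0 , e) → ≢0 , solve-for g (vsum gs) e))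
      (≤-reflexive (assoc-swap (ind (relation? j (y -v g) gs)) (q ^ (m * ind (g ≟ 0v))) (weight m gs)))

  Orthogonal : ∀ {n s} → Vec (Fin n) s → Vec (Vector n) s → Row n → Set
  Orthogonal C gs B = ∀ j → dot (lookup gs j) (lookup B (lookup C j)) ≡ 0#

  orthogonal-row? : ∀ {n s} (C : Vec (Fin n) s) (gs : Vec (Vector n) s) B → Dec (Orthogonal C gs B)
  orthogonal-row? C gs B = ∀? λ j → dot (lookup gs j) (lookup B (lookup C j)) ≟ 0#

  hyperplane-constraint : ∀ {n} → Vector n → Constraint n
  hyperplane-constraint {n} g = record
    { Holds = λ x → dot g x ≡ 0#
    ; holds? = λ x → dot g x ≟ 0#
    ; subgroup = record { zero∈ = dot-0ʳ g ; minus∈ = λ {x} {y} hx hy → dot-minusʳ-0 g x y (trans hx (sym hy)) }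
    ; codim = ind (¬? (g ≟ 0v))
    ; bound = size-bound (g ≟ 0v) }
    where
    size-bound : (d : Dec (g ≡ 0v)) → size (λ x → dot g x ≟ 0#) * q ^ ind (¬? d) ≤ q ^ n
    size-bound (yes _)  = ≤-trans (≤-reflexive (*-identityʳ _)) (≤-trans (∑-mono λ x → ind≤1 (dot g x ≟ 0#)) (≤-reflexive (card-Vector n)))
    size-bound (no g≢0) = ≤-reflexive (trans (cong (size (λ x → dot g x ≟ 0#) *_) (*-identityʳ q)) (trans (*-comm _ q) (hyperplane g g≢0)))

  orthogonal-row-count : ∀ {n s} (C : Vec (Fin n) s) → Injective (lookup C) → (gs : Vec (Vector n) s) →
    (∑ λ B → ind (independent? B ×-dec orthogonal-row? C gs B)) * q ^ s ≤ #bases n * q ^ zeros gs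
  orthogonal-row-count {n} {s} C inj gs = begin
    X * q ^ s                          ≡⟨ cong (λ z → X * q ^ z) s≡ ⟩
    X * q ^ (nonzeros + zeros gs)      ≡⟨ cong (X *_) (^-distribˡ-+-* q nonzeros (zeros gs)) ⟩
    X * (q ^ nonzeros * q ^ zeros gs)  ≡⟨ sym (*-assoc X (q ^ nonzeros) (q ^ zeros gs)) ⟩
    X * q ^ nonzeros * q ^ zeros gs    ≤⟨ *-monoˡ-≤ (q ^ zeros gs) (constrained-bases (lookup C) inj (λ j → hyperplane-constraint (lookup gs j))) ⟩
    #bases n * q ^ zeros gs            ∎
    where
    open ≤-Reasoning
    X = ∑ λ B → ind (independent? B ×-dec orthogonal-row? C gs B)
    nonzeros = ∑ λ j → ind (¬? (lookup gs j ≟ 0v))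
    s≡ : s ≡ nonzeros + zeros gs
    s≡ = sym (trans (sym (∑-+ _ _)) (trans (∑-cong λ j → trans (+-comm (ind (¬? (lookup gs j ≟ 0v))) _) (ind-¬ (lookup gs j ≟ 0v))) (card-Fin s)))

  orthogonal-families-count : ∀ {n s} m (C : Vec (Fin n) s) → Injective (lookup C) → (gs : Vec (Vector n) s) →
    (∑ λ (Bs : Vec (Row n) m) → ind (allBases? Bs ×-dec ∀? λ i → orthogonal-row? C gs (lookup Bs i))) * q ^ (m * s)
      ≤ #bases n ^ m * weight m gs
  orthogonal-families-count {n} {s} m C inj gs = begin
    X * q ^ (m * s)                       ≡⟨ cong₂ _*_ (trans (∑-cong λ Bs → ind-≡ (allBases? Bs ×-dec ∀? λ i → orthogonal-row? C gs (lookup Bs i))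
                                               (∀? λ i → row? (lookup Bs i)) (λ (h , k) i → h i , k i) (λ h → proj₁ ∘ h , proj₂ ∘ h))
                                               (count-all row? m)) (trans (cong (q ^_) (*-comm m s)) (sym (^-*-assoc q s m))) ⟩
    Y ^ m * (q ^ s) ^ m                   ≡⟨ sym (^-distribʳ-* m Y (q ^ s)) ⟩
    (Y * q ^ s) ^ m                       ≤⟨ ^-monoˡ-≤ m (orthogonal-row-count C inj gs) ⟩
    (#bases n * q ^ zeros gs) ^ m         ≡⟨ ^-distribʳ-* m (#bases n) (q ^ zeros gs) ⟩
    #bases n ^ m * (q ^ zeros gs) ^ m     ≡⟨ cong (#bases n ^ m *_) (trans (^-*-assoc q (zeros gs) m) (trans (cong (q ^_) (*-comm (zeros gs) m)) (sym (weight≡ m gs)))) ⟩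
    #bases n ^ m * weight m gs            ∎
    where
    open ≤-Reasoning
    X = ∑ λ (Bs : Vec (Row n) m) → ind (allBases? Bs ×-dec ∀? λ i → orthogonal-row? C gs (lookup Bs i))
    row? : ∀ B → Dec (LinearlyIndependent B × Orthogonal C gs B)
    row? B = independent? B ×-dec orthogonal-row? C gs B
    Y = ∑ λ B → ind (row? B)
    ^-distribʳ-* : ∀ m a b → (a * b) ^ m ≡ a ^ m * b ^ m
    ^-distribʳ-* zero    a b = refl
    ^-distribʳ-* (suc m) a b rewrite ^-distribʳ-* m a b = r a b (a ^ m) (b ^ m)
      where
      r : ∀ a b c d → a * b * (c * d) ≡ a * c * (b * d)
      r = solve-∀

  -- A linear relation among functionals annihilating the columns C, the coefficients being absorbed into gs.
  Related : ∀ {n m} → ℕ → Vec (Row n) m → Set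
  Related {n} s Bs = ∃ λ (C : Vec (Fin n) s) → Injective (lookup C) × ∃ λ j → ∃ λ gs →
                     Relation j 0v gs × (∀ i → Orthogonal C gs (lookup Bs i))

  related-at? : ∀ {n m s} (C : Vec (Fin n) s) j gs (Bs : Vec (Row n) m) → Dec (Relation j 0v gs × (∀ i → Orthogonal C gs (lookup Bs i)))
  related-at? C j gs Bs = relation? j 0v gs ×-dec ∀? λ i → orthogonal-row? C gs (lookup Bs i)

  related? : ∀ {n m} s (Bs : Vec (Row n) m) → Dec (AllBases Bs × Related s Bs)
  related? s Bs = allBases? Bs ×-dec ∃? λ C → injective? (lookup C) ×-dec ∃? λ j → ∃? λ gs → related-at? C j gs Bs

  -- For t = `suc s` columns there are about q to the n (t - 1) tuples with sum zero, and each
  -- survives `m` rows with probability about q to the -m t. For m = n - t the exponents leave n -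
  -- t², up to lower terms, which outweighs the n ^ t choices of columns when t is logarithmic in n.
  related-count : ∀ {n m} s → m ≤ n →
    (∑ λ (Bs : Vec (Row n) m) → ind (related? (suc s) Bs)) * q ^ (m * suc s) ≤ n ^ suc s * (suc s * (#bases n ^ m * (q ^ suc n) ^ s))
  related-count {n} {m} s m≤n = ≤-trans
    (union-count (related? (suc s)) (λ C Bs → allBases? Bs ×-dec injective? (lookup C) ×-dec ∃? λ j → ∃? λ gs → related-at? C j gs Bs) Q (suc s * N)
      (λ Bs (all , C , h) → C , all , h) (λ C → at C (injective? (lookup C))))
    (≤-reflexive (cong (_* (suc s * N)) (trans (card-Vec (suc s)) (cong (_^ suc s) (card-Fin n)))))
    where
    open ≤-Reasoning
    Q = q ^ (m * suc s)
    N = #bases n ^ m * (q ^ suc n) ^ s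
    at-j : ∀ C → Injective (lookup C) → (j : Fin (suc s)) →
           (∑ λ (Bs : Vec (Row n) m) → ind (allBases? Bs ×-dec ∃? λ gs → related-at? C j gs Bs)) * Q ≤ N
    at-j C inj j = begin
      (∑ λ (Bs : Vec (Row n) m) → ind (allBases? Bs ×-dec ∃? λ gs → related-at? C j gs Bs)) * Q
        ≤⟨ *-monoˡ-≤ Q (∑-mono λ Bs → union-bound (allBases? Bs ×-dec ∃? λ gs → related-at? C j gs Bs)
             (λ gs → relation? j 0v gs ×-dec (allBases? Bs ×-dec ∀? λ i → orthogonal-row? C gs (lookup Bs i)))
             (λ (all , gs , r , o) → gs , r , all , o)) ⟩
      (∑ λ (Bs : Vec (Row n) m) → ∑ λ gs → ind (relation? j 0v gs ×-dec (allBases? Bs ×-dec ∀? λ i → orthogonal-row? C gs (lookup Bs i)))) * Q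
        ≡⟨ cong (_* Q) (trans (∑-swap _) (∑-cong λ gs → trans
             (∑-cong λ Bs → ind-× (relation? j 0v gs) (allBases? Bs ×-dec ∀? λ i → orthogonal-row? C gs (lookup Bs i))) (∑-*ˡ (ind (relation? j 0v gs)) _))) ⟩
      (∑ λ gs → ind (relation? j 0v gs) * X gs) * Q
        ≡⟨ trans (sym (∑-*ʳ _ Q)) (∑-cong λ gs → *-assoc (ind (relation? j 0v gs)) (X gs) Q) ⟩
      (∑ λ gs → ind (relation? j 0v gs) * (X gs * Q))
        ≤⟨ ∑-mono (λ gs → *-monoʳ-≤ (ind (relation? j 0v gs)) (orthogonal-families-count m C inj gs)) ⟩
      (∑ λ gs → ind (relation? j 0v gs) * (#bases n ^ m * weight m gs))
        ≡⟨ trans (∑-cong λ gs → r (ind (relation? j 0v gs)) (#bases n ^ m) (weight m gs)) (∑-*ˡ (#bases n ^ m) _) ⟩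
      #bases n ^ m * (∑ λ gs → ind (relation? j 0v gs) * weight m gs)
        ≤⟨ *-monoʳ-≤ (#bases n ^ m) (relation-weight m≤n j 0v) ⟩
      N ∎
      where
      X = λ gs → ∑ λ (Bs : Vec (Row n) m) → ind (allBases? Bs ×-dec ∀? λ i → orthogonal-row? C gs (lookup Bs i))
      r : ∀ a b c → a * (b * c) ≡ b * (a * c)
      r = solve-∀
    at : ∀ C → Dec (Injective (lookup C)) →
         (∑ λ (Bs : Vec (Row n) m) → ind (allBases? Bs ×-dec injective? (lookup C) ×-dec ∃? λ j → ∃? λ gs → related-at? C j gs Bs)) * Q ≤ suc s * N
    at C (yes inj) = ≤-trans
      (union-count (λ Bs → allBases? Bs ×-dec injective? (lookup C) ×-dec ∃? λ j → ∃? λ gs → related-at? C j gs Bs)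
        (λ j Bs → allBases? Bs ×-dec ∃? λ gs → related-at? C j gs Bs) Q N
        (λ Bs (all , _ , j , h) → j , all , h) (at-j C inj))
      (≤-reflexive (cong (_* N) (card-Fin (suc s))))
    at C (no ¬inj) = ≤-trans (≤-reflexive (cong (_* Q) (trans
      (∑-cong λ Bs → ind-no (allBases? Bs ×-dec injective? (lookup C) ×-dec ∃? λ j → ∃? λ gs → related-at? C j gs Bs) λ (_ , inj , _) → ¬inj inj) ∑-0))) z≤n

  rare-relations : ∀ {n m} s → m ≤ n → n ^ suc s * (suc s * (q ^ suc n) ^ s) * q ^ suc s ≤ q ^ (m * suc s) →
    (∑ λ (Bs : Vec (Row n) m) → ind (related? (suc s) Bs)) * q ^ suc s ≤ #bases n ^ m
  rare-relations {n} {m} s m≤n h = *-cancelʳ-≤ _ _ (q ^ (m * suc s)) {{m^n≢0 q (m * suc s)}} (begin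
    X * q ^ suc s * q ^ (m * suc s)                    ≡⟨ r₁ X (q ^ suc s) (q ^ (m * suc s)) ⟩
    X * q ^ (m * suc s) * q ^ suc s                    ≤⟨ *-monoˡ-≤ (q ^ suc s) (related-count s m≤n) ⟩
    n ^ suc s * (suc s * (M * T)) * q ^ suc s          ≡⟨ r₂ (n ^ suc s) (suc s) M T (q ^ suc s) ⟩
    M * (n ^ suc s * (suc s * T) * q ^ suc s)          ≤⟨ *-monoʳ-≤ M h ⟩
    M * q ^ (m * suc s)                                ∎)
    where
    open ≤-Reasoning
    X = ∑ λ (Bs : Vec (Row n) m) → ind (related? (suc s) Bs)
    M = #bases n ^ m
    T = (q ^ suc n) ^ s
    r₁ : ∀ a b c → a * b * c ≡ a * c * b
    r₁ = solve-∀
    r₂ : ∀ a s M T c → a * (s * (M * T)) * c ≡ M * (a * (s * T) * c)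
    r₂ = solve-∀

  -- A dependence with coefficients `c` becomes the forbidden relation with entries
  -- `lookup c x ·v f (C x)`, a nonzero coefficient giving a nonzero entry. As `Related` ranges over
  -- all functionals, `f` may depend on anything chosen later.
  unrelated⇒independent : ∀ {n m s} {Bs : Vec (Row n) m} → ¬ Related s Bs → (f : Fin n → Vector n) →
    (∀ k → f k ≢ 0v) → (∀ k i → dot (f k) (lookup (lookup Bs i) k) ≡ 0#) →
    ∀ (C : Fin s → Fin n) → Injective C → LinearlyIndependent (tabulate (f ∘ C))
  unrelated⇒independent {n} {m} {s} {Bs} unrelated f f≢0 f⊥ C inj c e with ∃? (λ j → ¬? (lookup c j ≟ 0#))
  ... | no none = zero-vector c λ j → decidable-stable (lookup c j ≟ 0#) λ ≢0 → none (j , ≢0)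
    where
    zero-vector : ∀ {s} (c : Vec K s) → (∀ j → lookup c j ≡ 0#) → c ≡ 0v
    zero-vector []      h = refl
    zero-vector (a ∷ c) h = cong₂ _∷_ (h zero) (zero-vector c (h ∘ suc))
  ... | yes (j , cⱼ≢0) = contradiction (tabulate C , injective , j , gs , (gⱼ≢0 , trans (vsum-lincomb c (f ∘ C)) e) , orthogonal) unrelated
    where
    gs = tabulate λ x → lookup c x ·v f (C x)
    injective : Injective (lookup (tabulate C))
    injective x y e = inj x y (trans (sym (Vec.lookup∘tabulate C x)) (trans e (Vec.lookup∘tabulate C y)))
    gⱼ≢0 : lookup gs j ≢ 0v
    gⱼ≢0 e = ·v-nonzero cⱼ≢0 (f≢0 (C j)) (trans (sym (Vec.lookup∘tabulate _ j)) e)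
    vsum-lincomb : ∀ {s} (c : Vec K s) (h : Fin s → Vector n) → vsum (tabulate λ x → lookup c x ·v h x) ≡ lincomb c (tabulate h)
    vsum-lincomb []      h = refl
    vsum-lincomb (a ∷ c) h = cong ((a ·v h zero) +v_) (vsum-lincomb c (h ∘ suc))
    orthogonal : ∀ i → Orthogonal (tabulate C) gs (lookup Bs i)
    orthogonal i x = begin
      dot (lookup gs x) (lookup (lookup Bs i) (lookup (tabulate C) x))
        ≡⟨ cong₂ (λ g k → dot g (lookup (lookup Bs i) k)) (Vec.lookup∘tabulate _ x) (Vec.lookup∘tabulate C x) ⟩
      dot (lookup c x ·v f (C x)) (lookup (lookup Bs i) (C x))
        ≡⟨ dot-·ˡ (lookup c x) (f (C x)) _ ⟩
      lookup c x ⊗ dot (f (C x)) (lookup (lookup Bs i) (C x))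
        ≡⟨ cong (lookup c x ⊗_) (f⊥ (C x) i) ⟩
      lookup c x ⊗ 0#
        ≡⟨ R.zeroʳ (lookup c x) ⟩
      0# ∎
      where open ≡-Reasoning

  -- Processing the rows one at a time

  -- Written with `tabulate` to agree with the family in `TransversallyPartitionable`.
  transversal : ∀ {n i} → Vec (Row n) i → (Fin i → Permutation′ n) → Fin n → Vec (Vector n) i
  transversal Bs σ k = tabulate λ i → lookup (lookup Bs i) (σ i ⟨$⟩ʳ k)

  column≡ : ∀ {n m} (k : Fin n) (Bs : Vec (Row n) m) → column k Bs ≡ transversal Bs (λ _ → Perm.id) k
  column≡ k []       = refl
  column≡ k (B ∷ Bs) = cong (lookup B k ∷_) (column≡ k Bs)

  module _ {n s : ℕ} (s²≤n : s * s ≤ n) (m : ℕ) where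
    open Blocks {n} {s} s²≤n

    -- base is the unpermuted part of Bs, so its k-th column is part of the k-th transversal.
    record Arrangement {i : ℕ} (Bs : Vec (Row n) i) : Set where
      field
        σ           : Fin i → Permutation′ n
        independent : ∀ k → LinearlyIndependent (transversal Bs σ k)
        base        : Vec (Row n) m
        unrelated   : ¬ Related s base
        base⊥       : ∀ k f → dots (transversal Bs σ k) f ≡ 0v → ∀ i → dot f (lookup (lookup base i) k) ≡ 0#

    open Arrangement

    module _ {i : ℕ} (i<n : i < n) {Bs : Vec (Row n) i} (a : Arrangement Bs) where

      normal : Fin n → Vector n
      normal k = proj₁ (normal-exists i<n (transversal Bs (σ a) k))

      normal≢0 : ∀ k → normal k ≢ 0v
      normal≢0 k = proj₁ (proj₂ (normal-exists i<n (transversal Bs (σ a) k)))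

      normal⊥ : ∀ k → dots (transversal Bs (σ a) k) (normal k) ≡ 0v
      normal⊥ k = proj₂ (proj₂ (normal-exists i<n (transversal Bs (σ a) k)))

      normals-independent : ∀ (C : Fin s → Fin n) → Injective C → LinearlyIndependent (tabulate (normal ∘ C))
      normals-independent = unrelated⇒independent {Bs = base a} (unrelated a) normal normal≢0 λ k → base⊥ a k (normal k) (normal⊥ k)

      extend : ∀ B → Dec (BadStep normal B) → Maybe (Arrangement (B ∷ Bs))
      extend B (yes _)   = nothing
      extend B (no good) = just (record
        { σ = λ { zero → π ; (suc i) → σ a i }
        ; independent = λ k → independent-extend (normal k) (independent a k) (normal⊥ k) (proj₂ (good-permutation normal B good) k)
        ; base = base a
        ; unrelated = unrelated a
        -- A functional that kills the longer column also kills the shorter one, so the same `base`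
        -- serves after every step.
        ; base⊥ = λ k f e → base⊥ a k f (Vec.∷-injectiveʳ e) })
        where π = proj₁ (good-permutation normal B good)

    step : ∀ {i} → i < n → {Bs : Vec (Row n) i} → ∀ B → Maybe (Arrangement Bs) → Maybe (Arrangement (B ∷ Bs))
    step i<n B nothing  = nothing
    step i<n B (just a) = extend i<n a B (badStep? (normal i<n a) B)

    start : (Bs : Vec (Row n) m) → Dec (∃ λ k → ¬ LinearlyIndependent (column k Bs)) → Dec (Related s Bs) → Maybe (Arrangement Bs)
    start Bs (no li) (no unrelated) = just (record
      { σ = λ _ → Perm.id
      ; independent = λ k → subst LinearlyIndependent (column≡ k Bs) (decidable-stable (independent? (column k Bs)) λ h → li (k , h))
      ; base = Bs
      ; unrelated = unrelated
      ; base⊥ = λ k f e i → trans (dot-comm f _) (dots-zero⁻ (λ i → lookup (lookup Bs i) k) f e i) })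
    start Bs _ _ = nothing

    some-column? : (Bs : Vec (Row n) m) → Dec (∃ λ k → ¬ LinearlyIndependent (column k Bs))
    some-column? Bs = ∃? λ k → ¬? (independent? (column k Bs))

    has-relation? : (Bs : Vec (Row n) m) → Dec (Related s Bs)
    has-relation? Bs = ∃? λ C → injective? (lookup C) ×-dec ∃? λ j → ∃? λ gs → related-at? C j gs Bs

    -- New rows enter at the head. The arrangement of the tail, and with it the normals, is fixed
    -- before `B` is inspected, so a sum over `B` for a fixed tail treats them as constants.
    run : ∀ r → r + m ≤ n → (Bs : Vec (Row n) (r + m)) → Maybe (Arrangement Bs)
    run zero    _  Bs       = start Bs (some-column? Bs) (has-relation? Bs)
    run (suc r) le (B ∷ Bs) = step le B (run r (<⇒≤ le) Bs)

    -- Counting the families on which the process fails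

    fails? : ∀ {i} {Bs : Vec (Row n) i} (x : Maybe (Arrangement Bs)) → Dec (AllBases Bs × x ≡ nothing)
    fails? {Bs = Bs} x = allBases? Bs ×-dec nothing? x

    failures : ∀ r → r + m ≤ n → ℕ
    failures r le = ∑ λ Bs → ind (fails? (run r le Bs))

    start-fails : ∀ Bs (d : Dec (∃ λ k → ¬ LinearlyIndependent (column k Bs))) (e : Dec (Related s Bs)) →
                  AllBases Bs × start Bs d e ≡ nothing → (AllBases Bs × ∃ λ k → ¬ LinearlyIndependent (column k Bs)) ⊎ (AllBases Bs × Related s Bs)
    start-fails Bs (yes d) e       (all , _) = inj₁ (all , d)
    start-fails Bs (no _)  (yes r) (all , _) = inj₂ (all , r)

    module _ (s-large : n ^ s * n ^ s * q ^ s ≤ q ^ (s * s)) where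

      private
        M = #bases n
        c = 2 * (n * s) + 1

      -- A failure is either inherited, and then shared by every continuation, or caused by a bad
      -- step, which has probability at most `c` times q⁻ˢ. The two cases of `x` each account for
      -- one summand.
      step-failures : ∀ {i} (i<n : i < n) {Bs : Vec (Row n) i} (x : Maybe (Arrangement Bs)) →
        (∑ λ B → ind (fails? (step i<n B x))) * q ^ s ≤ (ind (fails? x) * q ^ s + ind (allBases? Bs) * c) * M
      step-failures i<n {Bs} nothing = begin
        (∑ λ B → ind (fails? (step i<n {Bs} B nothing))) * q ^ s  ≤⟨ *-monoˡ-≤ (q ^ s) (∑-mono λ B →
          ≤-trans (ind-mono (fails? (step i<n {Bs} B nothing)) (fails? {Bs = Bs} nothing ×-dec independent? B) λ (all , e) → (all ∘ suc , refl) , all zero)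
                  (≤-reflexive (ind-× (fails? {Bs = Bs} nothing) (independent? B)))) ⟩
        (∑ λ (B : Row n) → a * ind (independent? B)) * q ^ s      ≡⟨ cong (_* q ^ s) (∑-*ˡ a _) ⟩
        a * M * q ^ s                                             ≡⟨ r a M (q ^ s) ⟩
        a * q ^ s * M                                             ≤⟨ *-monoˡ-≤ M (m≤m+n (a * q ^ s) _) ⟩
        (a * q ^ s + ind (allBases? Bs) * c) * M                  ∎
        where
        open ≤-Reasoning
        a = ind (fails? {Bs = Bs} nothing)
        r : ∀ a b c → a * b * c ≡ a * c * b
        r = solve-∀
      step-failures i<n {Bs} (just x) = begin
        (∑ λ B → ind (fails? (step i<n B (just x)))) * q ^ s        ≤⟨ *-monoˡ-≤ (q ^ s) (∑-mono λ B →
          ≤-trans (ind-mono (fails? (step i<n B (just x))) (allBases? Bs ×-dec (independent? B ×-dec badStep? f B))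
                     λ (all , e) → all ∘ suc , all zero , extend-fails B (badStep? f B) e)
                  (≤-reflexive (ind-× (allBases? Bs) (independent? B ×-dec badStep? f B)))) ⟩
        (∑ λ B → b * ind (independent? B ×-dec badStep? f B)) * q ^ s  ≡⟨ trans (cong (_* q ^ s) (∑-*ˡ b _)) (*-assoc b _ (q ^ s)) ⟩
        b * ((∑ λ B → ind (independent? B ×-dec badStep? f B)) * q ^ s) ≤⟨ *-monoʳ-≤ b (badStep-count f (normal≢0 i<n x) (normals-independent i<n x) s-large) ⟩
        b * (c * M)                                                  ≡⟨ sym (*-assoc b c M) ⟩
        b * c * M                                                    ≤⟨ *-monoˡ-≤ M (m≤n+m (b * c) (ind (fails? (just x)) * q ^ s)) ⟩
        (ind (fails? (just x)) * q ^ s + b * c) * M                  ∎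
        where
        open ≤-Reasoning
        f = normal i<n x
        b = ind (allBases? Bs)
        extend-fails : ∀ B (d : Dec (BadStep f B)) → extend i<n x B d ≡ nothing → BadStep f B
        extend-fails B (yes bad) _ = bad

      -- The failure probability in units of q⁻ˢ: `n` for dependent columns of the unpermuted part,
      -- 1 for relations, then `c` for each added row.
      failures-bound : s + m ≡ n → (∑ λ (Bs : Vec (Row n) m) → ind (related? s Bs)) * q ^ s ≤ M ^ m →
                       ∀ r le → failures r le * q ^ s ≤ (n + 1 + r * c) * M ^ (r + m)
      failures-bound s+m≡n few-related zero le = begin
        failures 0 le * q ^ s  ≤⟨ *-monoˡ-≤ (q ^ s) (∑-mono λ Bs →
          ind-⊎ (fails? (run 0 le Bs)) (some-dependent? Bs) (related? s Bs) (start-fails Bs (some-column? Bs) (has-relation? Bs))) ⟩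
        (∑ λ Bs → ind (some-dependent? Bs) + ind (related? s Bs)) * q ^ s   ≡⟨ cong (_* q ^ s) (∑-+ _ _) ⟩
        (X + Y) * q ^ s                                                      ≡⟨ *-distribʳ-+ (q ^ s) X Y ⟩
        X * q ^ s + Y * q ^ s                                                ≤⟨ +-mono-≤ (some-dependent-count s m s+m≡n) few-related ⟩
        n * M ^ m + M ^ m                                                    ≡⟨ r n (M ^ m) ⟩
        (n + 1 + 0) * M ^ m                                                  ∎
        where
        open ≤-Reasoning
        X = ∑ λ (Bs : Vec (Row n) m) → ind (some-dependent? Bs)
        Y = ∑ λ (Bs : Vec (Row n) m) → ind (related? s Bs)
        r : ∀ n A → n * A + A ≡ (n + 1 + 0) * A
        r = solve-∀
      failures-bound s+m≡n few-related (suc r) le = begin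
        failures (suc r) le * q ^ s
          ≡⟨ cong (_* q ^ s) (trans (∑-Vec _) (∑-swap _)) ⟩
        (∑ λ Bs → ∑ λ B → ind (fails? (step le B (run r (<⇒≤ le) Bs)))) * q ^ s
          ≡⟨ sym (∑-*ʳ _ (q ^ s)) ⟩
        (∑ λ Bs → (∑ λ B → ind (fails? (step le B (run r (<⇒≤ le) Bs)))) * q ^ s)
          ≤⟨ ∑-mono (λ Bs → step-failures le (run r (<⇒≤ le) Bs)) ⟩
        (∑ λ Bs → (ind (fails? (run r (<⇒≤ le) Bs)) * q ^ s + ind (allBases? Bs) * c) * M)
          ≡⟨ trans (∑-*ʳ _ M) (cong (_* M) (trans (∑-+ _ _) (cong₂ _+_ (∑-*ʳ _ (q ^ s)) (∑-*ʳ _ c)))) ⟩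
        (failures r (<⇒≤ le) * q ^ s + (∑ λ (Bs : Vec (Row n) (r + m)) → ind (allBases? Bs)) * c) * M
          ≡⟨ cong (λ z → (failures r (<⇒≤ le) * q ^ s + z * c) * M) (families-count n (r + m)) ⟩
        (failures r (<⇒≤ le) * q ^ s + M ^ (r + m) * c) * M
          ≤⟨ *-monoˡ-≤ M (+-monoˡ-≤ (M ^ (r + m) * c) (failures-bound s+m≡n few-related r (<⇒≤ le))) ⟩
        ((n + 1 + r * c) * M ^ (r + m) + M ^ (r + m) * c) * M
          ≡⟨ collect n r c (M ^ (r + m)) M ⟩
        (n + 1 + suc r * c) * (M * M ^ (r + m)) ∎
        where
        open ≤-Reasoning
        collect : ∀ n r c A M → ((n + 1 + r * c) * A + A * c) * M ≡ (n + 1 + (c + r * c)) * (M * A)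
        collect = solve-∀

  -- From arrangements to the proportion of bad families

  arrangement⇒partitionable : ∀ n s (s²≤n : s * s ≤ n) m {Bs : BasisFamily n} →
                              Arrangement {n} {s} s²≤n m Bs → TransversallyPartitionable Bs
  arrangement⇒partitionable n s s²≤n m a = σ , λ k → independent⇒basis (independent k)
    where open Arrangement {n} {s} {s²≤n} {m} a

  bad-bound : ∀ s m → let n = s + m in s * s ≤ n → n ^ s * n ^ s * q ^ s ≤ q ^ (s * s) →
              (∑ λ (Bs : Vec (Row n) m) → ind (related? s Bs)) * q ^ s ≤ #bases n ^ m →
              ∀ {total bad} → HasSize (Prob.Ω F n) total → HasSize (Prob.BadΩ F n) bad →
              bad * q ^ s ≤ (n + 1 + s * (2 * (n * s) + 1)) * total
  bad-bound s m s²≤n s-large few-related {total} {bad} sizeΩ sizeBad = begin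
    bad * q ^ s                                                   ≤⟨ *-monoˡ-≤ (q ^ s) (size≤ (λ Bs → fails? {n} {s} s²≤n m (run {n} {s} s²≤n m s ≤-refl Bs)) bad⇒fails sizeBad) ⟩
    failures {n} {s} s²≤n m s ≤-refl * q ^ s                              ≤⟨ failures-bound {n} {s} s²≤n m s-large refl few-related s ≤-refl ⟩
    c * #bases n ^ n                                              ≡⟨ cong (c *_) (sym (families-count n n)) ⟩
    c * (∑ λ (Bs : Vec (Row n) n) → ind (allBases? Bs))           ≤⟨ *-monoʳ-≤ c (≤size allBases? (λ Bs all i → independent⇒basis (all i)) sizeΩ) ⟩
    c * total                                                     ∎
    where
    open ≤-Reasoning
    n = s + m
    c = n + 1 + s * (2 * (n * s) + 1)
    -- Partitionability is never decided: an arrangement of all n rows would yield a partition, so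
    -- on a bad family the process can only have returned `nothing`.
    bad⇒fails : ∀ Bs → (∀ i → IsBasis (lookup Bs i)) × ¬ TransversallyPartitionable Bs →
                AllBases Bs × run {n} {s} s²≤n m s ≤-refl Bs ≡ nothing
    bad⇒fails Bs (bases , bad) = (λ i → proj₁ (bases i)) , is-nothing (run {n} {s} s²≤n m s ≤-refl Bs)
      where
      is-nothing : (x : Maybe (Arrangement {n} {s} s²≤n m Bs)) → x ≡ nothing
      is-nothing nothing  = refl
      is-nothing (just a) = contradiction (arrangement⇒partitionable n s s²≤n m a) bad

  -- Choice of the parameters

  -- `s` is presented as a successor because a tuple with prescribed sum has s′ free entries. The
  -- left side of `gap≤m` is what the comparison of exponents in `few-related` leaves to be bounded
  -- by `m`.
  module _ (u s′ m k : ℕ) (s≡5v : suc s′ ≡ 5 * suc u)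
           (gap≤m : suc u * suc s′ + suc u + suc s′ * suc s′ + suc s′ ≤ m) where

    private
      v s n : ℕ
      v = suc u
      s = suc s′
      n = s + m

    module _ (n<2^v : n < 2 ^ v) where

      private
        2^v≤q^v : 2 ^ v ≤ q ^ v
        2^v≤q^v = ^-monoˡ-≤ v q≥2

        n≤q^v : n ≤ q ^ v
        n≤q^v = ≤-trans (<⇒≤ n<2^v) 2^v≤q^v

        n^s≤ : n ^ s ≤ q ^ (v * s)
        n^s≤ = ≤-trans (^-monoˡ-≤ s n≤q^v) (≤-reflexive (^-*-assoc q v s))

      pairs-small : n ^ s * n ^ s * q ^ s ≤ q ^ (s * s)
      pairs-small = begin
        n ^ s * n ^ s * q ^ s               ≤⟨ *-monoˡ-≤ (q ^ s) (*-mono-≤ n^s≤ n^s≤) ⟩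
        q ^ (v * s) * q ^ (v * s) * q ^ s   ≡⟨ cong (_* q ^ s) (sym (^-distribˡ-+-* q (v * s) (v * s))) ⟩
        q ^ (v * s + v * s) * q ^ s         ≡⟨ sym (^-distribˡ-+-* q (v * s + v * s) s) ⟩
        -- With s = 5 v the slack s - 2 v - 1 equals 3 u + 2.
        q ^ (v * s + v * s + s)             ≤⟨ ^-monoʳ-≤ q (≤-trans (m≤m+n _ ((2 + 3 * u) * s)) (≤-reflexive (trans (r u s) (cong (_* s) (sym s≡5v))))) ⟩
        q ^ (s * s)                         ∎
        where
        open ≤-Reasoning
        r : ∀ u s → suc u * s + suc u * s + s + (2 + 3 * u) * s ≡ 5 * suc u * s
        r = solve-∀

      few-related : (∑ λ (Bs : Vec (Row n) m) → ind (related? s Bs)) * q ^ s ≤ #bases n ^ m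
      few-related = rare-relations s′ (m≤n+m m s) (begin
        n ^ s * (s * (q ^ suc n) ^ s′) * q ^ s              ≤⟨ *-monoˡ-≤ (q ^ s) (*-mono-≤ n^s≤ (*-mono-≤ s≤q^v (≤-reflexive (^-*-assoc q (suc n) s′)))) ⟩
        q ^ (v * s) * (q ^ v * q ^ (suc n * s′)) * q ^ s    ≡⟨ sym powers ⟩
        q ^ (v * s + (v + suc n * s′) + s)                  ≤⟨ ^-monoʳ-≤ q exponents ⟩
        q ^ (m * s)                                         ∎)
        where
        open ≤-Reasoning
        s≤q^v : s ≤ q ^ v
        s≤q^v = ≤-trans (m≤m+n s m) n≤q^v
        powers : q ^ (v * s + (v + suc n * s′) + s) ≡ q ^ (v * s) * (q ^ v * q ^ (suc n * s′)) * q ^ s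
        powers = trans (^-distribˡ-+-* q (v * s + (v + suc n * s′)) s) (cong (_* q ^ s)
          (trans (^-distribˡ-+-* q (v * s) (v + suc n * s′)) (cong (q ^ (v * s) *_) (^-distribˡ-+-* q v (suc n * s′)))))
        exponents : v * s + (v + suc n * s′) + s ≤ m * s
        exponents = begin
          -- The added 1 completes s′ + 1 to s, so that the sum becomes the left side of `gap≤m`
          -- plus m * s′.
          v * s + (v + suc n * s′) + s                ≤⟨ n≤1+n _ ⟩
          suc (v * s + (v + suc n * s′) + s)          ≡⟨ identity (v * s) v s′ m ⟩
          v * s + v + s * s + s + m * s′              ≤⟨ +-monoˡ-≤ (m * s′) gap≤m ⟩
          m + m * s′                                  ≡⟨ sym (*-suc m s′) ⟩
          m * s                                       ∎
          where
          identity : ∀ a v s′ m → suc (a + (v + suc (suc s′ + m) * s′) + suc s′) ≡ a + v + suc s′ * suc s′ + suc s′ + m * s′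
          identity = solve-∀

      -- With Y = 2 ^ v, a bound for k, n and s, the left side is at most 2 Y² + 2 Y⁴ ≤ 4 Y⁴ ≤ Y⁵ =
      -- 2 ^ s. This fifth power is the reason for the factor 5 in s = 5 v.
      constants : k ≤ n → k * (n + 1 + s * (2 * (n * s) + 1)) ≤ q ^ s
      constants k≤n = begin
        k * (n + 1 + s * (2 * (n * s) + 1))     ≤⟨ *-mono-≤ (≤-trans k≤n n≤Y) (+-mono-≤ (≤-trans (≤-reflexive (+-comm n 1)) n<2^v)
                                                     (*-mono-≤ s≤Y (+-monoˡ-≤ 1 (*-monoʳ-≤ 2 (*-mono-≤ n≤Y s≤Y))))) ⟩
        Y * (Y + Y * (2 * (Y * Y) + 1))         ≡⟨ r₁ Y ⟩
        2 * (Y * Y) * 1 + 2 * (Y * Y) * (Y * Y) ≤⟨ +-monoˡ-≤ _ (*-monoʳ-≤ (2 * (Y * Y)) (*-mono-≤ Y≥1 Y≥1)) ⟩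
        2 * (Y * Y) * (Y * Y) + 2 * (Y * Y) * (Y * Y) ≡⟨ r₂ Y ⟩
        4 * (Y * (Y * (Y * (Y * 1))))           ≤⟨ *-monoˡ-≤ (Y * (Y * (Y * (Y * 1)))) Y≥4 ⟩
        Y ^ 5                                   ≡⟨ trans (^-*-assoc 2 v 5) (cong (2 ^_) (trans (*-comm v 5) (sym s≡5v))) ⟩
        2 ^ s                                   ≤⟨ ^-monoˡ-≤ s q≥2 ⟩
        q ^ s                                   ∎
        where
        open ≤-Reasoning
        Y = 2 ^ v
        n≤Y : n ≤ Y
        n≤Y = <⇒≤ n<2^v
        s≤Y : s ≤ Y
        s≤Y = ≤-trans (m≤m+n s m) n≤Y
        Y≥4 : 4 ≤ Y
        Y≥4 = ≤-trans (≤-trans (n≤1+n 4) (≤-trans (m≤m*n 5 v) (≤-reflexive (sym s≡5v)))) s≤Y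
        Y≥1 : 1 ≤ Y
        Y≥1 = ≤-trans (s≤s z≤n) Y≥4
        r₁ : ∀ Y → Y * (Y + Y * (2 * (Y * Y) + 1)) ≡ 2 * (Y * Y) * 1 + 2 * (Y * Y) * (Y * Y)
        r₁ = solve-∀
        r₂ : ∀ Y → 2 * (Y * Y) * (Y * Y) + 2 * (Y * Y) * (Y * Y) ≡ 4 * (Y * (Y * (Y * (Y * 1))))
        r₂ = solve-∀

      s²≤n : s * s ≤ n
      s²≤n = ≤-trans (≤-trans (m≤n+m (s * s) (v * s + v)) (≤-trans (m≤m+n _ s) gap≤m)) (m≤n+m m s)

      negligible : k ≤ n → ∀ {total bad} → HasSize (Prob.Ω F n) total → HasSize (Prob.BadΩ F n) bad → k * bad ≤ total
      negligible k≤n {total} {bad} sizeΩ sizeBad = *-cancelʳ-≤ (k * bad) total (q ^ s) {{m^n≢0 q s}} (begin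
        k * bad * q ^ s     ≡⟨ *-assoc k bad (q ^ s) ⟩
        k * (bad * q ^ s)   ≤⟨ *-monoʳ-≤ k (bad-bound s m s²≤n pairs-small few-related sizeΩ sizeBad) ⟩
        k * (c * total)     ≡⟨ sym (*-assoc k c total) ⟩
        k * c * total       ≤⟨ *-monoˡ-≤ total (constants k≤n) ⟩
        q ^ s * total       ≡⟨ *-comm (q ^ s) total ⟩
        total * q ^ s       ∎)
        where
        open ≤-Reasoning
        c = n + 1 + s * (2 * (n * s) + 1)

theorem1p2 : ∀ (q : ℕ) (F : FiniteField q) (k : ℕ) →
    ∃ λ (N : ℕ) → ∀ (n : ℕ) → N ≤ n →
    ∀ (total bad : ℕ) →
    HasSize (Prob.Ω F n) total → HasSize (Prob.BadΩ F n) bad →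
    k * bad ≤ total
-- The summand k gives k ≤ n, which `constants` uses; the summand 2 ^ 14 makes the binary logarithm
-- of n at least 14, where `square≤exponential` starts.
theorem1p2 q F k = k + 2 ^ 14 , λ n N≤n total bad →
  at n (m+n≤o⇒m≤o k N≤n) (m+n≤o⇒n≤o k N≤n)
  where
  at : ∀ n → k ≤ n → 2 ^ 14 ≤ n → ∀ {total bad} → HasSize (Prob.Ω F n) total → HasSize (Prob.BadΩ F n) bad → k * bad ≤ total
  at n k≤n large = split (binary-magnitude n (≤-trans (^-monoʳ-≤ 2 {0} {14} z≤n) large))
    where
    split : (∃ λ u → 2 ^ u ≤ n × n < 2 ^ suc u) →
            ∀ {total bad} → HasSize (Prob.Ω F n) total → HasSize (Prob.BadΩ F n) bad → k * bad ≤ total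
    split (u , 2^u≤n , n<2^1+u) = conclude (m≤n⇒∃[o]m+o≡n s≤n)
      where
      -- With n < 2ᵛ, s = 5 v makes qˢ beat k n s² while s² = O(log² n) stays below n.
      v s gap : ℕ
      v = suc u
      s = suc (4 + 5 * u)
      gap = v * s + v + s * s + s
      14≤u : 14 ≤ u
      14≤u = ≮⇒≥ λ u<14 → <⇒≱ n<2^1+u (≤-trans (^-monoʳ-≤ 2 u<14) large)
      s+gap≤n : s + gap ≤ n
      s+gap≤n = ≤-trans (≤-trans (≤-trans (m≤m+n _ (11 * suc u * u)) (≤-reflexive (r u))) (square≤exponential (≤⇒≤′ 14≤u))) 2^u≤n
        where
        r : ∀ u → let v = suc u ; s = suc (4 + 5 * u) in s + (v * s + v + s * s + s) + 11 * suc u * u ≡ 41 * (suc u * suc u)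
        r = solve-∀
      s≤n : s ≤ n
      s≤n = m+n≤o⇒m≤o s s+gap≤n
      s≡5v : s ≡ 5 * v
      s≡5v = sym (*-suc 5 u)
      conclude : (∃ λ m → s + m ≡ n) →
                 ∀ {total bad} → HasSize (Prob.Ω F n) total → HasSize (Prob.BadΩ F n) bad → k * bad ≤ total
      conclude (m , refl) = OverField.negligible F u (4 + 5 * u) m k s≡5v (+-cancelˡ-≤ s gap m s+gap≤n) n<2^1+u k≤n
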